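{- Let $n\ge 3$, let $\mathcal{D}$ be a dissection of a convex $n$-gon $P_n$ into $m$ pieces, and let $W_{\mathcal{D}}(x;q)=(v_{i,j})_{1\le i,j\le n}$ be the associated weight matrix (with edge weights). Then $$v_{j,i}=\psi_{\mathcal{D}}(v_{i,j})\qquad\text{for all }1\le i,j\le n,$$ i.e. $W_{\mathcal{D}}(x;q)$ is complementary symmetric with respect to $\psi_{\mathcal{D}}$: $W_{\mathcal{D}}(x;q)^t=(\psi_{\mathcal{D}}(v_{i,j}))_{i,j}$.
   Context: $P_n$ is a convex $n$-gon ($n\ge3$) with vertices labelled $1,2,\ldots,n$ in counterclockwise order, labels being taken modulo $n$. A dissection $\mathcal{D}$ of $P_n$ is obtained by drawing $m-1$ ($m\ge 1$) pairwise noncrossing diagonals, which cut $P_n$ into $m$ polygons $\alpha_1,\ldots,\alpha_m$, called the pieces of the dissection; one writes $\mathcal{D}=\{\alpha_1,\ldots,\alpha_m\}$. If $\alpha_l$ has $d_l$ vertices, it is called a piece of degree $d_l$. For vertices $i,j$, a (counterclockwise) walk from $i$ to $j$ around $P_n$ is a sequence $w=(p_{i+1},p_{i+2},\ldots,p_{j-1})$ of pieces of $\mathcal{D}$, indexed by the vertices strictly between $i$ and $j$ when going counterclockwise from $i$ to $j$ (labels modulo $n$), such that: (i) $p_k$ is incident to vertex $k$ (i.e. $k$ is a vertex of $p_k$) for all $k\in\{i+1,\ldots,j-1\}$; (ii) each piece $\alpha\in\mathcal{D}$ of degree $d$ appears at most $d-2$ times among $p_{i+1},\ldots,p_{j-1}$.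 By convention, for $i=j$ there is no walk from $i$ to $i$; for $j=i+1$ (modulo $n$) the empty sequence is the unique walk from $i$ to $i+1$. To each piece $\alpha_l$ an indeterminate $x_l=x(\alpha_l)$ is associated, and to each boundary edge $e_i$ of $P_n$ joining $i$ and $i+1$ (modulo $n$) an indeterminate $q_i$. The weight of a walk $w=(p_{i+1},\ldots,p_{j-1})$ from $i$ to $j$ is the monomial $x^wq^w$ with $x^w=\prod_{k=i+1}^{j-1}x(p_k)$ and $q^w=\prod_{s=i}^{j-1}q_s$ (products taken counterclockwise from $i$ to $j$, indices modulo $n$; so $q^w$ is the product of the weights of the edges traversed). The weight matrix $W_{\mathcal{D}}(x;q)=W_{\mathcal{D}}(x_1,\ldots,x_m;q_1,\ldots,q_n)=(v_{i,j})_{1\le i,j\le n}$ has entries $v_{i,j}=\sum_w x^wq^w$, the sum over all walks $w$ from $i$ to $j$ (so $v_{i,i}=0$, $v_{i,i+1}=q_i$). Complementing map: let $\mathrm{Pol}_{\mathcal{D}}(x;q)$ be the set of $f\in\mathbb{Z}[x_1,\ldots,x_m;q_1,\ldots,q_n]$ with $\deg_{x_i}f\le d_i-2$ for all $i$ and $\deg_{q_j}f\le 1$ for all $j$. The linear map $\psi_{\mathcal{D}}:\mathrm{Pol}_{\mathcal{D}}(x;q)\to\mathrm{Pol}_{\mathcal{D}}(x;q)$ is defined on monomials by $\psi_{\mathcal{D}}\left(\prod_{i=1}^m x_i^{a_i}\prod_{j\in I}q_j\right)=\prod_{i=1}^m x_i^{d_i-2-a_i}\prod_{j\notin I}q_j$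 for $I\subseteq\{1,\ldots,n\}$, and extended linearly. -}

module Defs where

open import Data.Bool.Base using (if_then_else_)
open import Data.Empty using (⊥-elim)
open import Data.Fin.Base as Fin using (Fin; toℕ)
import Data.Fin.Properties as Fin
open import Data.Fin.Subset using (Subset; ⊤; _∩_; _∈_; ∣_∣)
open import Data.Fin.Subset.Properties using (_∈?_)
open import Data.Integer.Base as ℤ using (ℤ; 0ℤ; 1ℤ)
open import Data.List.Base as List
  using (List; []; _∷_; _++_; length; map; filter; allFin; cartesianProductWith)
import Data.List.Membership.Propositional as List
open import Data.List.Membership.Propositional.Properties
  using (∈-map⁻; ∈-filter⁻)
open import Data.List.Relation.Binary.Pointwise as Pointwise using (Pointwise)
open import Data.List.Relation.Unary.All as All using (All; []; _∷_)
import Data.List.Relation.Unary.All.Properties as All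
open import Data.List.Relation.Unary.AllPairs using (AllPairs; []; _∷_)
open import Data.List.Relation.Unary.Any using (here; there)
open import Data.List.Relation.Unary.Unique.Propositional using (Unique)
import Data.List.Relation.Unary.Unique.Propositional.Properties as Unique
open import Data.Nat.Base as ℕ using (ℕ; zero; suc; _∸_; _≤_; z≤n; s≤s)
import Data.Nat.Properties as ℕ
open import Data.Product.Base using (_×_; _,_; proj₁; proj₂; Σ-syntax)
open import Data.Product.Properties using () renaming (≡-dec to ×-≡-dec)
open import Data.Sum.Base using (_⊎_)
open import Data.Vec.Base as Vec using (Vec)
import Data.Vec.Properties as Vec
open import Relation.Binary.Definitions using (DecidableEquality)
open import Relation.Binary.PropositionalEquality
  using (_≡_; _≢_; refl; sym; subst)
open import Relation.Nullary using (¬_; Dec; yes; no; does; ¬?; _×-dec_; _⊎-dec_)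

-- Dissections.  The vertices of Pₙ are the elements of Fin n, in
-- counterclockwise order 0, 1, …, n-1.

-- A segment joining two vertices, given by its smaller and larger endpoint.
Chord : ℕ → Set
Chord n = Fin n × Fin n

-- The endpoints are in order and at least one vertex lies strictly on
-- each side; the second inequality excludes the boundary edge {0 , n-1}.
IsDiagonal : ∀ {n} → Chord n → Set
IsDiagonal {n} (a , b) =
  suc (toℕ a) ℕ.< toℕ b × suc (toℕ b) ℕ.< toℕ a ℕ.+ n

Crosses : ∀ {n} → Chord n → Chord n → Set
Crosses (a , b) (c , d) =
    (a Fin.< c × c Fin.< b × b Fin.< d)
  ⊎ (c Fin.< a × a Fin.< d × d Fin.< b)

record Dissection (n : ℕ) : Set where
  field
    diagonals   : List (Chord n)
    areDiagonal : All IsDiagonal diagonals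
    distinct    : Unique diagonals
    noncrossing : AllPairs (λ e f → ¬ Crosses e f) diagonals

-- The vertices on either closed side of the chord.
inner outer : ∀ {n} → Chord n → Subset n
inner (a , b) = Vec.tabulate λ k → does ((a Fin.≤? k) ×-dec (k Fin.≤? b))
outer (a , b) = Vec.tabulate λ k → does ((k Fin.≤? a) ⊎-dec (b Fin.≤? k))

-- The polygons, given by their vertex sets, into which the polygon with
-- vertex set S is cut by a list of chords.  For the diagonals of a
-- dissection, which are distinct and noncrossing, the next diagonal meets
-- the interior of the polygon S exactly when both its endpoints are in S.
cut : ∀ {n} → List (Chord n) → Subset n → List (Subset n)
cut []             S = S ∷ []
cut ((a , b) ∷ es) S =
  if does ((a ∈? S) ×-dec (b ∈? S))
  then cut es (S ∩ inner (a , b)) ++ cut es (S ∩ outer (a , b))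
  else cut es S

module _ {n : ℕ} (D : Dissection n) where
  open Dissection D

  pieces : List (Subset n)
  pieces = cut diagonals ⊤

  #pieces : ℕ
  #pieces = length pieces

  piece : Fin #pieces → Subset n
  piece = List.lookup pieces

  degree : Fin #pieces → ℕ
  degree l = ∣ piece l ∣

-- The vertices i+1, …, j-1 (modulo n), in this order.
between : ∀ {n} → Fin n → Fin n → List (Fin n)
between {n} i j with i Fin.≤? j
... | yes _ = filter (λ k → (i Fin.<? k) ×-dec (k Fin.<? j)) (allFin n)
... | no  _ = filter (i Fin.<?_) (allFin n) ++ filter (Fin._<? j) (allFin n)

occurrences : ∀ {k} → Fin k → List (Fin k) → ℕ
occurrences l w = length (filter (l Fin.≟_) w)

words : (k len : ℕ) → List (List (Fin k))
words k zero      = [] ∷ []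
words k (suc len) = cartesianProductWith _∷_ (allFin k) (words k len)

module _ {n : ℕ} (D : Dissection n) where

  IsWalk : Fin n → Fin n → List (Fin (#pieces D)) → Set
  IsWalk i j w =
      i ≢ j
    × Pointwise (λ k p → k ∈ piece D p) (between i j) w
    × (∀ l → occurrences l w ≤ degree D l ∸ 2)

  isWalk? : ∀ i j w → Dec (IsWalk i j w)
  isWalk? i j w =
    ¬? (i Fin.≟ j)
    ×-dec Pointwise.decidable (λ k p → k ∈? piece D p) (between i j) w
    ×-dec Fin.all? (λ l → occurrences l w ℕ.≤? degree D l ∸ 2)

  walks : Fin n → Fin n → List (List (Fin (#pieces D)))
  walks i j = filter (isWalk? i j) (words (#pieces D) (length (between i j)))

-- The polynomial ring ℤ[x₁,…,xₘ;q₁,…,qₙ] (as a ℤ-module): formal sums of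
-- terms, two of them being equal when all their coefficients agree.

-- The exponents of the x's and of the q's.
Monomial : ℕ → ℕ → Set
Monomial m n = Vec ℕ m × Vec ℕ n

_≟ᴹ_ : ∀ {m n} → DecidableEquality (Monomial m n)
_≟ᴹ_ = ×-≡-dec (Vec.≡-dec ℕ._≟_) (Vec.≡-dec ℕ._≟_)

Poly : ℕ → ℕ → Set
Poly m n = List (ℤ × Monomial m n)

coeff : ∀ {m n} → Poly m n → Monomial m n → ℤ
coeff []            μ = 0ℤ
coeff ((c , ν) ∷ f) μ = if does (ν ≟ᴹ μ) then c ℤ.+ coeff f μ else coeff f μ

degx_≤_at_ : ∀ {m n} → Poly m n → ℕ → Fin m → Set
degx f ≤ d at l = ∀ μ → coeff f μ ≢ 0ℤ → Vec.lookup (proj₁ μ) l ≤ d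

degq_≤_at_ : ∀ {m n} → Poly m n → ℕ → Fin n → Set
degq f ≤ d at s = ∀ μ → coeff f μ ≢ 0ℤ → Vec.lookup (proj₂ μ) s ≤ d

-- The exponent vector of the product of the variables listed in w.
∏ : ∀ {k} → List (Fin k) → Vec ℕ k
∏ w = Vec.tabulate λ l → occurrences l w

coeff≢0⇒∈ : ∀ {m n} (f : Poly m n) {μ} → coeff f μ ≢ 0ℤ → μ List.∈ map proj₂ f
coeff≢0⇒∈ []            c≢0 = ⊥-elim (c≢0 refl)
coeff≢0⇒∈ ((c , ν) ∷ f) {μ} c≢0 with ν ≟ᴹ μ
... | yes ν≡μ = here (sym ν≡μ)
... | no  _   = there (coeff≢0⇒∈ f c≢0)

unique-between : ∀ {n} (i j : Fin n) → i ≢ j → Unique (i ∷ between i j)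
unique-between {n} i j i≢j with i Fin.≤? j
... | yes _ =
      All.map (λ { p refl → ℕ.<-irrefl refl (proj₁ p) })
              (All.all-filter (λ k → (i Fin.<? k) ×-dec (k Fin.<? j)) (allFin n))
    ∷ Unique.filter⁺ (λ k → (i Fin.<? k) ×-dec (k Fin.<? j)) (Unique.allFin⁺ n)
... | no i≰j =
      All.++⁺
        (All.map (λ { p refl → ℕ.<-irrefl refl p })
                 (All.all-filter (i Fin.<?_) (allFin n)))
        (All.map (λ { p refl → i≰j (ℕ.<⇒≤ p) })
                 (All.all-filter (Fin._<? j) (allFin n)))
    ∷ Unique.++⁺
        (Unique.filter⁺ (i Fin.<?_) (Unique.allFin⁺ n))
        (Unique.filter⁺ (Fin._<? j) (Unique.allFin⁺ n))
        λ (p , q) → i≰j (ℕ.<⇒≤ (ℕ.<-trans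
          (proj₂ (∈-filter⁻ (i Fin.<?_) {xs = allFin n} p))
          (proj₂ (∈-filter⁻ (Fin._<? j) {xs = allFin n} q))))

unique⇒occurrences≤1 : ∀ {k} {w : List (Fin k)} (l : Fin k) →
                       Unique w → occurrences l w ≤ 1
unique⇒occurrences≤1 l [] = z≤n
unique⇒occurrences≤1 {w = k ∷ w} l (k∉w ∷ u) with l Fin.≟ k
... | no  _    = unique⇒occurrences≤1 l u
... | yes refl = s≤s (ℕ.≤-reflexive (none k∉w))
  where
  none : ∀ {w} → All (l ≢_) w → occurrences l w ≡ 0
  none [] = refl
  none {k ∷ _} (l≢k ∷ ps) with l Fin.≟ k
  ... | yes l≡k = ⊥-elim (l≢k l≡k)
  ... | no  _   = none ps

module _ {n : ℕ} (D : Dissection n) where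

  IsPol : Poly (#pieces D) n → Set
  IsPol f = (∀ l → degx f ≤ (degree D l ∸ 2) at l) × (∀ s → degq f ≤ 1 at s)

  Pol : Set
  Pol = Σ[ f ∈ Poly (#pieces D) n ] IsPol f

  infix 4 _≈_

  _≈_ : Pol → Pol → Set
  (f , _) ≈ (g , _) = ∀ μ → coeff f μ ≡ coeff g μ

  -- The edge from s to s+1 is indexed by s, so the edges traversed on the
  -- way from i to j are indexed by i, i+1, …, j-1.
  weight : Fin n → Fin n → List (Fin (#pieces D)) → Monomial (#pieces D) n
  weight i j w = ∏ w , ∏ (i ∷ between i j)

  walkSum : Fin n → Fin n → Poly (#pieces D) n
  walkSum i j = map (λ w → 1ℤ , weight i j w) (walks D i j)

  -- On the monomials occurring in elements of Pol, ∸ does not truncate.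
  complement : Monomial (#pieces D) n → Monomial (#pieces D) n
  complement (a , e) =
      Vec.tabulate (λ l → (degree D l ∸ 2) ∸ Vec.lookup a l)
    , Vec.tabulate (λ s → 1 ∸ Vec.lookup e s)

  -- The ℤ-linear extension of complement.
  complementSum : Poly (#pieces D) n → Poly (#pieces D) n
  complementSum = map λ (c , μ) → c , complement μ

  private
    Bounded : Monomial (#pieces D) n → Set
    Bounded (a , e) =
      (∀ l → Vec.lookup a l ≤ degree D l ∸ 2) × (∀ s → Vec.lookup e s ≤ 1)

    bounded⇒isPol : ∀ f → (∀ t → t List.∈ f → Bounded (proj₂ t)) → IsPol f
    bounded⇒isPol f b =
      (λ l μ c≢0 → proj₁ (bounded μ c≢0) l) , (λ s μ c≢0 → proj₂ (bounded μ c≢0) s)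
      where
      bounded : ∀ μ → coeff f μ ≢ 0ℤ → Bounded μ
      bounded μ c≢0 with ∈-map⁻ proj₂ (coeff≢0⇒∈ f c≢0)
      ... | t , t∈f , refl = b t t∈f

  walkSum-isPol : ∀ i j → IsPol (walkSum i j)
  walkSum-isPol i j = bounded⇒isPol (walkSum i j) bounded
    where
    bounded : ∀ t → t List.∈ walkSum i j → Bounded (proj₂ t)
    bounded t t∈ with ∈-map⁻ _ t∈
    ... | w , w∈ , refl
      with _ , i≢j , _ , occ ← ∈-filter⁻ (isWalk? D i j)
             {xs = words (#pieces D) (length (between i j))} w∈ =
        (λ l → subst (_≤ _) (sym (Vec.lookup∘tabulate _ l)) (occ l))
      , (λ s → subst (_≤ 1) (sym (Vec.lookup∘tabulate _ s))
                 (unique⇒occurrences≤1 s (unique-between i j i≢j)))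

  complementSum-isPol : ∀ f → IsPol (complementSum f)
  complementSum-isPol f = bounded⇒isPol (complementSum f) bounded
    where
    bounded : ∀ t → t List.∈ complementSum f → Bounded (proj₂ t)
    bounded t t∈ with ∈-map⁻ _ t∈
    ... | (c , a , e) , _ , refl =
        (λ l → subst (_≤ _) (sym (Vec.lookup∘tabulate _ l))
                 (ℕ.m∸n≤m (degree D l ∸ 2) (Vec.lookup a l)))
      , (λ s → subst (_≤ 1) (sym (Vec.lookup∘tabulate _ s))
                 (ℕ.m∸n≤m 1 (Vec.lookup e s)))

  W : Fin n → Fin n → Pol
  W i j = walkSum i j , walkSum-isPol i j

  ψ : Pol → Pol
  ψ (f , _) = complementSum f , complementSum-isPol f

-- Both W and ψ are compatible with cutting the polygon along a diagonal {u , v}.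
-- Let N(i,j) be the generating function of the walks from i to j, and N₁, N₂
-- those of the two parts.  If i and j lie on the same side, the walks in one of
-- the two directions run through all vertices strictly on the other side; these
-- use up all pieces there, so that N(i,j) = N₁(i,j) N₂(u,v) for one of the two
-- directions and N₁(i,j) N₂(v,u) for the other.  If i and j lie strictly on
-- different sides, the walk passes exactly one of u and v, say u, and
-- N(i,j) = N₁(i,v) N₂(u,j) + N₁(i,u) N₂(v,j).  Complementing interchanges the two
-- summands, and induction on the list of diagonals applies.

module Submission where

open import Defs
open import Data.Nat.Base
open import Data.Fin.Base as Fin using (Fin; zero; suc)
open import Data.Bool.Base using (Bool; true; false; if_then_else_)
open import Data.Empty using (⊥)
import Data.Fin.Properties as Fin
open import Data.Fin.Subset using (Subset; _∈_; _∉_; _⊆_; _∩_; ⊤; ∣_∣)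
open import Data.Fin.Subset.Properties
  using (_∈?_; ∈⊤; x∈p∩q⁺; x∈p∩q⁻; ⊆-refl; p∩q⊆p; drop-there)
open import Data.Integer.Base as ℤ using (0ℤ; 1ℤ)
open import Data.List.Base
  using (List; []; _∷_; _++_; length; filter; allFin; tabulate; map; cartesianProductWith; lookup)
import Data.List.Membership.Propositional as List
open import Data.List.Membership.Propositional.Properties using (∈-++⁻; ∈-filter⁺; ∈-allFin)
open import Data.List.Properties
  using ( ++-assoc; ++-identityʳ; ∷-injective; length-++; map-∘; map-tabulate; tabulate-cong
        ; filter-++; filter-all; filter-none; filter-some; filter-accept; filter-reject; filter-≐)
open import Data.List.Relation.Binary.Permutation.Propositional
  using (_↭_; refl; prep; swap; trans; ↭-refl; ↭-sym; ↭-trans; ↭-reflexive)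
open import Data.List.Relation.Binary.Permutation.Propositional.Properties
  using (++-commutativeMonoid; ++-comm; ↭-length; filter-↭)
open import Data.List.Relation.Binary.Pointwise as Pointwise using (Pointwise; []; _∷_)
open import Data.List.Relation.Unary.All as All using (All; []; _∷_) renaming (tail to drop-∷)
open import Data.List.Relation.Unary.All.Properties using (++⁺; ++⁻ˡ; ++⁻ʳ; all-filter)
open import Data.List.Relation.Unary.AllPairs using (AllPairs; []; _∷_)
import Data.List.Relation.Unary.AllPairs.Properties as AllPairs
open import Data.List.Relation.Unary.Any using (here; there)
import Data.List.Relation.Unary.Unique.Propositional.Properties as Unique
open import Data.Nat.ListAction using (sum)
open import Data.Nat.Properties
open import Data.Product.Base using (_×_; _,_; proj₁; proj₂; ∃-syntax)
open import Data.Sum.Base using (_⊎_; inj₁; inj₂; [_,_]′)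
open import Data.Vec.Base as Vec using (Vec; []; _∷_; _[_]≔_; _[_]%=_)
import Data.Vec.Properties as Vec
open import Function.Base using (_∘_; id)
open import Level using (0ℓ)
open import Relation.Binary.Definitions using (tri<; tri≈; tri>)
open import Relation.Binary.PropositionalEquality as ≡
  using (_≡_; _≢_; refl; cong; cong₂; sym; subst; module ≡-Reasoning)
open import Relation.Nullary using (¬_; Dec; yes; no; does; contradiction; _×-dec_; _⊎-dec_)
open import Relation.Nullary.Decidable using (dec-true; dec-false)
open import Relation.Unary using (Pred; Decidable; _≐_)

-- Counting the ways to fill a list of vertices with prescribed pieces

-- For i ≠ j all walks from i to j have the same edge monomial, and that of the walks from j to i is
-- its complement, so the real content concerns the exponents of the x's. The bounds d - 2 are built
-- in by comparing only contents c and d whose entries add up to them: the claim becomes that one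
-- arc can be filled with content c in as many ways as the other with content d. This speaks only of
-- a list of pieces and two lists of vertices, hence applies to every polygon met while cutting.
-- That a walk around the far side uses up all pieces there is not obtained by adding up degrees.
-- The ends of the diagonal are adjacent in that part, so the induction hypothesis compares the
-- empty walk, with generating function 1, to the walk around; the top monomial then has coefficient
-- 1 in a product of linear forms, and homogeneity fixes its degree.

lower : (ℕ → ℕ) → ℕ → ℕ
lower f zero    = 0
lower f (suc a) = f a

-- Multiplication by x(p) or by 0, according to incidence, seen on coefficients: x f has at x^a the
-- coefficient of f at x^(a-1), whence the value 0 of `lower` at `zero`.
lowerIf : Bool → (ℕ → ℕ) → ℕ → ℕ
lowerIf b f a = if b then lower f a else 0

lowerIf-cong : ∀ b {f g} a → (∀ {a′} → suc a′ ≡ a → f a′ ≡ g a′) →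
               lowerIf b f a ≡ lowerIf b g a
lowerIf-cong false a       f≈g = refl
lowerIf-cong true  zero    f≈g = refl
lowerIf-cong true  (suc a) f≈g = f≈g refl

module _ {n : ℕ} where

  private variable
    P Q : List (Subset n)
    X X′ Y Y′ : List (Fin n)

  -- The exponents of a monomial in the x's. With `All` they are indexed by the pieces themselves,
  -- and `++⁺` joins contents as `++` joins the pieces on the two sides of a diagonal.
  Content : List (Subset n) → Set
  Content P = All (λ _ → ℕ) P

  total : Content P → ℕ
  total []      = 0
  total (a ∷ c) = a + total c

  -- Multiplication of the generating function f by the linear form Σ x(p), where
  -- p runs through the pieces incident to k; thus count ks is the coefficient
  -- function of the product of these forms over the vertices k in ks.
  step : Fin n → (Content P → ℕ) → Content P → ℕ
  step {P = []}    k f []      = 0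
  step {P = p ∷ P} k f (a ∷ c) =
    lowerIf (does (k ∈? p)) (λ b → f (b ∷ c)) a + step k (λ d → f (a ∷ d)) c

  isZero : Content P → ℕ
  isZero []          = 1
  isZero (zero  ∷ c) = isZero c
  isZero (suc _ ∷ c) = 0

  count : List (Fin n) → Content P → ℕ
  count []       c = isZero c
  count (k ∷ ks) c = step k (count ks) c

  -- Each summand of `step` spends one copy of one piece, so f is evaluated only at contents whose
  -- total is smaller by one.
  step-cong-total : ∀ (k : Fin n) {f g : Content P → ℕ} c →
                    (∀ d → suc (total d) ≡ total c → f d ≡ g d) →
                    step k f c ≡ step k g c
  step-cong-total {P = []}    k []      f≈g = refl
  step-cong-total {P = p ∷ P} k (a ∷ c) f≈g = cong₂ _+_
    (lowerIf-cong (does (k ∈? p)) a λ { refl → f≈g _ refl })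
    (step-cong-total k c λ d eq →
      f≈g _ (≡.trans (sym (+-suc a (total d))) (cong (a +_) eq)))

  step-cong : ∀ (k : Fin n) {f g : Content P → ℕ} →
              (∀ d → f d ≡ g d) → ∀ c → step k f c ≡ step k g c
  step-cong k f≈g c = step-cong-total k c λ d _ → f≈g d

  step-*ʳ : ∀ (k : Fin n) (f : Content P → ℕ) x c →
            step k (λ d → f d * x) c ≡ step k f c * x
  step-*ʳ {P = []}    k f x []      = refl
  step-*ʳ {P = p ∷ P} k f x (a ∷ c) = ≡.trans
    (cong₂ _+_ (lowerIf-* (does (k ∈? p)) a) (step-*ʳ k _ x c))
    (sym (*-distribʳ-+ x (lowerIf (does (k ∈? p)) _ a) _))
    where
    lowerIf-* : ∀ b {f} a → lowerIf b (λ a′ → f a′ * x) a ≡ lowerIf b f a * x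
    lowerIf-* false a       = refl
    lowerIf-* true  zero    = refl
    lowerIf-* true  (suc a) = refl

  step-*ˡ : ∀ (k : Fin n) (f : Content P → ℕ) x c →
            step k (λ d → x * f d) c ≡ x * step k f c
  step-*ˡ k f x c = ≡.trans (step-cong k (λ d → *-comm x (f d)) c)
    (≡.trans (step-*ʳ k f x c) (*-comm _ x))

  step-0 : ∀ (k : Fin n) (c : Content P) → step k (λ _ → 0) c ≡ 0
  step-0 k c = ≡.trans (step-*ʳ k (λ _ → 0) 0 c) (*-zeroʳ (step k (λ _ → 0) c))

  step-+ : ∀ (k : Fin n) (f g : Content P → ℕ) c →
           step k (λ d → f d + g d) c ≡ step k f c + step k g c
  step-+ {P = []}    k f g []      = refl
  step-+ {P = p ∷ P} k f g (a ∷ c) = ≡.trans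
    (cong₂ _+_ (lowerIf-+ (does (k ∈? p)) a) (step-+ k _ _ c))
    (interchange (lowerIf (does (k ∈? p)) _ a) _ _ _)
    where
    open import Algebra.Properties.CommutativeSemigroup +-commutativeSemigroup
      using (interchange)
    lowerIf-+ : ∀ b {f g} a →
                lowerIf b (λ a′ → f a′ + g a′) a ≡ lowerIf b f a + lowerIf b g a
    lowerIf-+ false a       = refl
    lowerIf-+ true  zero    = refl
    lowerIf-+ true  (suc a) = refl

  step-++ : ∀ (k : Fin n) (f : Content (P ++ Q) → ℕ) (c : Content P) (d : Content Q) →
            step k f (++⁺ c d) ≡
            step k (λ c′ → f (++⁺ c′ d)) c + step k (λ d′ → f (++⁺ c d′)) d
  step-++ {P = []}    k f []      d = refl
  step-++ {P = p ∷ P} k f (a ∷ c) d = ≡.trans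
    (cong (lowerIf (does (k ∈? p)) _ a +_) (step-++ k _ c d))
    (sym (+-assoc (lowerIf (does (k ∈? p)) _ a) _ _))

  Avoids : List (Subset n) → Fin n → Set
  Avoids P k = All (k ∉_) P

  step-avoids : ∀ {k : Fin n} → Avoids P k → ∀ f (c : Content P) → step k f c ≡ 0
  step-avoids []            f []      = refl
  step-avoids {k = k} (_∷_ {p} k∉p k∉P) f (a ∷ c)
    rewrite dec-false (k ∈? p) k∉p = step-avoids k∉P _ c

  step-swap : ∀ (k l : Fin n) (f : Content P → ℕ) c →
              step k (step l f) c ≡ step l (step k f) c
  step-swap {P = []}    k l f []      = refl
  step-swap {P = p ∷ P} k l f (a ∷ c) = begin
    lowerIf β (λ b → lowerIf γ (F c) b + step l (λ d → f (b ∷ d)) c) a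
      + step k (λ d → lowerIf γ (F d) a + step l (λ d′ → f (a ∷ d′)) d) c
      -- Four terms, according to whether each of k and l takes the head piece p or a later one;
      -- exchanging k and l exchanges the two mixed terms.
      ≡⟨ expand k l f a c ⟩
    (lowerIf β (lowerIf γ (F c)) a + step l (λ d → lowerIf β (F d) a) c)
      + (step k (λ d → lowerIf γ (F d) a) c + step k (step l (λ d → f (a ∷ d))) c)
      ≡⟨ interchange (lowerIf β (lowerIf γ (F c)) a) _ _ _ ⟩
    (lowerIf β (lowerIf γ (F c)) a + step k (λ d → lowerIf γ (F d) a) c)
      + (step l (λ d → lowerIf β (F d) a) c + step k (step l (λ d → f (a ∷ d))) c)
      ≡⟨ cong₂ (λ x y → (x + step k (λ d → lowerIf γ (F d) a) c)
                         + (step l (λ d → lowerIf β (F d) a) c + y))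
               (both β γ a) (step-swap k l _ c) ⟩
    (lowerIf γ (lowerIf β (F c)) a + step k (λ d → lowerIf γ (F d) a) c)
      + (step l (λ d → lowerIf β (F d) a) c + step l (step k (λ d → f (a ∷ d))) c)
      ≡⟨ expand l k f a c ⟨
    lowerIf γ (λ b → lowerIf β (F c) b + step k (λ d → f (b ∷ d)) c) a
      + step l (λ d → lowerIf β (F d) a + step k (λ d′ → f (a ∷ d′)) d) c
      ∎
    where
    open ≡-Reasoning
    open import Algebra.Properties.CommutativeSemigroup +-commutativeSemigroup
      using (interchange)
    β = does (k ∈? p)
    γ = does (l ∈? p)
    F : Content P → ℕ → ℕ
    F d b = f (b ∷ d)
    both : ∀ β γ {g} a → lowerIf β (lowerIf γ g) a ≡ lowerIf γ (lowerIf β g) a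
    both false false a       = refl
    both false true  zero    = refl
    both false true  (suc a) = refl
    both true  false zero    = refl
    both true  false (suc a) = refl
    both true  true  a       = refl
    distr : ∀ β (l : Fin _) (f : Content (p ∷ P) → ℕ) g a c →
            lowerIf β (λ b → g b + step l (λ d → f (b ∷ d)) c) a ≡
            lowerIf β g a + step l (λ d → lowerIf β (λ b → f (b ∷ d)) a) c
    distr false l f g a       c = sym (step-0 l c)
    distr true  l f g zero    c = sym (step-0 l c)
    distr true  l f g (suc a) c = refl
    expand : ∀ k l (f : Content (p ∷ P) → ℕ) a c →
      step k (step l f) (a ∷ c) ≡
      (lowerIf (does (k ∈? p)) (lowerIf (does (l ∈? p)) (λ b → f (b ∷ c))) a
        + step l (λ d → lowerIf (does (k ∈? p)) (λ b → f (b ∷ d)) a) c)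
      + (step k (λ d → lowerIf (does (l ∈? p)) (λ b → f (b ∷ d)) a) c
        + step k (step l (λ d → f (a ∷ d))) c)
    expand k l f a c = cong₂ _+_ (distr (does (k ∈? p)) l f _ a c) (step-+ k _ _ c)

  -- Linear forms commute, so a walk enters only through the multiset of its inner vertices; this
  -- absorbs the wraparound of the cyclic order.
  count-↭ : X ↭ Y → (c : Content P) → count X c ≡ count Y c
  count-↭ refl          c = refl
  count-↭ (prep k X↭Y)  c = step-cong k (count-↭ X↭Y) c
  count-↭ (swap {X} k l X↭Y) c = ≡.trans (step-swap k l (count X) c)
    (step-cong l (step-cong k (count-↭ X↭Y)) c)
  count-↭ (trans p q) c = ≡.trans (count-↭ p c) (count-↭ q c)

  -- Homogeneity: a product of linear forms has degree equal to the number of factors.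
  count-total : ∀ (X : List (Fin n)) (c : Content P) → total c ≢ length X → count X c ≡ 0
  count-total []      []          ≢0 = contradiction refl ≢0
  count-total []      (zero  ∷ c) ≢0 = count-total [] c ≢0
  count-total []      (suc a ∷ c) ≢0 = refl
  count-total (k ∷ X) c           ≢  = ≡.trans
    (step-cong-total k c λ d eq → count-total X d λ eq′ →
      ≢ (≡.trans (sym eq) (cong suc eq′)))
    (step-0 k c)

  isZero-++ : ∀ (c : Content P) (d : Content Q) → isZero (++⁺ c d) ≡ isZero c * isZero d
  isZero-++ []          d = sym (+-identityʳ _)
  isZero-++ (zero  ∷ c) d = isZero-++ c d
  isZero-++ (suc a ∷ c) d = refl

  count-swap : ∀ (X : List (Fin n)) (c : Content P) (d : Content Q) →
               count X (++⁺ c d) ≡ count X (++⁺ d c)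
  count-swap []      c d = isZero-swap c d
    where
    isZero-swap : ∀ (c : Content P) (d : Content Q) → isZero (++⁺ c d) ≡ isZero (++⁺ d c)
    isZero-swap c d = ≡.trans (isZero-++ c d)
      (≡.trans (*-comm (isZero c) _) (sym (isZero-++ d c)))
  count-swap (k ∷ X) c d = begin
    step k (count X) (++⁺ c d)
      ≡⟨ step-++ k (count X) c d ⟩
    step k (λ c′ → count X (++⁺ c′ d)) c + step k (λ d′ → count X (++⁺ c d′)) d
      ≡⟨ +-comm (step k _ c) _ ⟩
    step k (λ d′ → count X (++⁺ c d′)) d + step k (λ c′ → count X (++⁺ c′ d)) c
      ≡⟨ cong₂ _+_ (step-cong k (λ d′ → count-swap X c d′) d)
                   (step-cong k (λ c′ → count-swap X c′ d) c) ⟩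
    step k (λ d′ → count X (++⁺ d′ c)) d + step k (λ c′ → count X (++⁺ d c′)) c
      ≡⟨ step-++ k (count X) d c ⟨
    step k (count X) (++⁺ d c)
      ∎
    where open ≡-Reasoning

  -- The forms of X contain only variables of P and those of Y only variables of Q, so the
  -- coefficients of the product factor.
  count-mixed : All (Avoids Q) X → All (Avoids P) Y → (c : Content P) (d : Content Q) →
                count (X ++ Y) (++⁺ c d) ≡ count X c * count Y d
  count-mixed {X = []} {Y = []} _ _ c d = isZero-++ c d
  count-mixed {X = []} {Y = k ∷ Y} X∉Q (k∉P ∷ Y∉P) c d = begin
    step k (count Y) (++⁺ c d)
      ≡⟨ step-++ k (count Y) c d ⟩
    step k (λ c′ → count Y (++⁺ c′ d)) c + step k (λ d′ → count Y (++⁺ c d′)) d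
      ≡⟨ cong (_+ step k (λ d′ → count Y (++⁺ c d′)) d) (step-avoids k∉P _ c) ⟩
    step k (λ d′ → count Y (++⁺ c d′)) d
      ≡⟨ step-cong k (count-mixed [] Y∉P c) d ⟩
    step k (λ d′ → isZero c * count Y d′) d
      ≡⟨ step-*ˡ k (count Y) (isZero c) d ⟩
    isZero c * step k (count Y) d
      ∎
    where open ≡-Reasoning
  count-mixed {X = k ∷ X} {Y = Y} (k∉Q ∷ X∉Q) Y∉P c d = begin
    step k (count (X ++ Y)) (++⁺ c d)
      ≡⟨ step-++ k (count (X ++ Y)) c d ⟩
    step k (λ c′ → count (X ++ Y) (++⁺ c′ d)) c
      + step k (λ d′ → count (X ++ Y) (++⁺ c d′)) d
      ≡⟨ cong (step k _ c +_) (step-avoids k∉Q _ d) ⟩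
    step k (λ c′ → count (X ++ Y) (++⁺ c′ d)) c + 0
      ≡⟨ +-identityʳ _ ⟩
    step k (λ c′ → count (X ++ Y) (++⁺ c′ d)) c
      ≡⟨ step-cong k (λ c′ → count-mixed X∉Q Y∉P c′ d) c ⟩
    step k (λ c′ → count X c′ * count Y d) c
      ≡⟨ step-*ʳ k (count X) (count Y d) c ⟩
    step k (count X) c * count Y d
      ∎
    where open ≡-Reasoning

  -- The form of k, an end of the diagonal in the application, is a form in the variables of P plus
  -- one in those of Q; `count-mixed` handles each summand.
  count-shared : ∀ k → All (Avoids Q) X → All (Avoids P) Y →
                 (c : Content P) (d : Content Q) →
                 count (k ∷ X ++ Y) (++⁺ c d) ≡
                 count (k ∷ X) c * count Y d + count X c * count (k ∷ Y) d
  count-shared {X = X} {Y = Y} k X∉Q Y∉P c d = begin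
    step k (count (X ++ Y)) (++⁺ c d)
      ≡⟨ step-++ k (count (X ++ Y)) c d ⟩
    step k (λ c′ → count (X ++ Y) (++⁺ c′ d)) c
      + step k (λ d′ → count (X ++ Y) (++⁺ c d′)) d
      ≡⟨ cong₂ _+_ (step-cong k (λ c′ → count-mixed X∉Q Y∉P c′ d) c)
                   (step-cong k (λ d′ → count-mixed X∉Q Y∉P c d′) d) ⟩
    step k (λ c′ → count X c′ * count Y d) c
      + step k (λ d′ → count X c * count Y d′) d
      ≡⟨ cong₂ _+_ (step-*ʳ k (count X) (count Y d) c) (step-*ˡ k (count Y) (count X c) d) ⟩
    step k (count X) c * count Y d + count X c * step k (count Y) d
      ∎
    where open ≡-Reasoning

  -- The vertices of X exhaust d, so none of those in Y can use a piece of Q.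
  count-saturated : ∀ Y → All (Avoids P) X → (c : Content P) (d : Content Q) →
                    total d ≤ length X →
                    count (Y ++ X) (++⁺ c d) ≡ count Y c * count X d
  count-saturated []      X∉P c d d≤X = count-mixed [] X∉P c d
  count-saturated {X = X} (k ∷ Y) X∉P c d d≤X = begin
    step k (count (Y ++ X)) (++⁺ c d)
      ≡⟨ step-++ k (count (Y ++ X)) c d ⟩
    step k (λ c′ → count (Y ++ X) (++⁺ c′ d)) c
      + step k (λ d′ → count (Y ++ X) (++⁺ c d′)) d
      ≡⟨ cong₂ _+_ (step-cong k (λ c′ → count-saturated Y X∉P c′ d d≤X) c)
                   (step-cong-total k d overfull) ⟩
    step k (λ c′ → count Y c′ * count X d) c + step k (λ _ → 0) d
      ≡⟨ cong₂ _+_ (step-*ʳ k (count Y) (count X d) c) (step-0 k d) ⟩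
    step k (count Y) c * count X d + 0
      ≡⟨ +-identityʳ _ ⟩
    step k (count Y) c * count X d
      ∎
    where
    open ≡-Reasoning
    overfull : ∀ d′ → suc (total d′) ≡ total d → count (Y ++ X) (++⁺ c d′) ≡ 0
    overfull d′ eq = ≡.trans
      (count-saturated Y X∉P c d′ (<⇒≤ d′<X))
      (≡.trans (cong (count Y c *_) (count-total X d′ (<⇒≢ d′<X)))
               (*-zeroʳ (count Y c)))
      where
      d′<X : total d′ < length X
      d′<X = ≤-trans (≤-reflexive eq) d≤X

  -- The additive condition is symmetric in a and b and keeps both within the bound, so neither
  -- truncation nor the bound on walks has to be treated separately.
  data Complementary : Content P → Content P → Set where
    []  : Complementary [] []
    _∷_ : ∀ {p a b} {c d : Content P} → a + b ≡ ∣ p ∣ ∸ 2 → Complementary c d →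
          Complementary {p ∷ P} (a ∷ c) (b ∷ d)

  Complementary-sym : ∀ {c d : Content P} → Complementary c d → Complementary d c
  Complementary-sym []                     = []
  Complementary-sym (_∷_ {a = a} {b} eq c) = ≡.trans (+-comm b a) eq ∷ Complementary-sym c

  Complementary-++⁻ : ∀ {e f : Content (P ++ Q)} → Complementary e f →
    ∃[ c ] ∃[ d ] ∃[ c′ ] ∃[ d′ ] e ≡ ++⁺ c d × f ≡ ++⁺ c′ d′
      × Complementary {P} c c′ × Complementary {Q} d d′
  Complementary-++⁻ {P = []}    e = [] , _ , [] , _ , refl , refl , [] , e
  Complementary-++⁻ {P = p ∷ P} (eq ∷ e) with Complementary-++⁻ {P = P} e
  ... | _ , _ , _ , _ , refl , refl , c , d =
    _ ∷ _ , _ , _ ∷ _ , _ , refl , refl , eq ∷ c , d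

  empty : ∀ P → Content P
  empty []      = []
  empty (p ∷ P) = 0 ∷ empty P

  full : ∀ P → Content P
  full []      = []
  full (p ∷ P) = ∣ p ∣ ∸ 2 ∷ full P

  empty-full : ∀ P → Complementary (empty P) (full P)
  empty-full []      = []
  empty-full (p ∷ P) = refl ∷ empty-full P

  count-empty : ∀ P → count [] (empty P) ≡ 1
  count-empty []      = refl
  count-empty (p ∷ P) = count-empty P

  Complementary⇒total≤ : ∀ {c d : Content P} → Complementary c d → total c ≤ total (full P)
  Complementary⇒total≤ []       = z≤n
  Complementary⇒total≤ (eq ∷ c) =
    +-mono-≤ (≤-trans (m≤m+n _ _) (≤-reflexive eq)) (Complementary⇒total≤ c)

  -- The effect of ψ on coefficients: within the degree bounds, the generating function of Y is the
  -- complement of that of X.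
  record Balanced (P : List (Subset n)) (X Y : List (Fin n)) : Set where
    field balance : ∀ {c d : Content P} → Complementary c d → count X c ≡ count Y d

  open Balanced public

  Balanced-sym : Balanced P X Y → Balanced P Y X
  Balanced-sym bal .balance e = sym (bal .balance (Complementary-sym e))

  Balanced-↭ : X ↭ X′ → Y ↭ Y′ → Balanced P X Y → Balanced P X′ Y′
  Balanced-↭ X↭X′ Y↭Y′ bal .balance {c} {d} e =
    ≡.trans (count-↭ (↭-sym X↭X′) c) (≡.trans (bal .balance e) (count-↭ Y↭Y′ d))

  Balanced-swap : Balanced (P ++ Q) X Y → Balanced (Q ++ P) X Y
  Balanced-swap {P} {Q} {X} {Y} bal .balance e with Complementary-++⁻ {P = Q} e
  ... | c , d , c′ , d′ , refl , refl , e₁ , e₂ = ≡.trans (count-swap X c d)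
    (≡.trans (bal .balance (Complementary-++⁺ e₂ e₁)) (count-swap Y d′ c′))
    where
    Complementary-++⁺ : ∀ {P Q} {c c′ : Content P} {d d′ : Content Q} →
      Complementary c c′ → Complementary d d′ → Complementary (++⁺ c d) (++⁺ c′ d′)
    Complementary-++⁺ []        f = f
    Complementary-++⁺ (eq ∷ e) f = eq ∷ Complementary-++⁺ e f

  -- count Y takes the value 1 on full P, so total (full P) must be the length of Y.
  Balanced-saturated : Balanced P [] Y → ∀ {c d : Content P} → Complementary c d →
                       total c ≤ length Y
  Balanced-saturated {P} {Y} bal e with total (full P) ≟ length Y
  ... | yes eq = ≤-trans (Complementary⇒total≤ e) (≤-reflexive eq)
  ... | no ≢Y  = contradiction
    (≡.trans (sym (count-empty P))
      (≡.trans (bal .balance (empty-full P)) (count-total Y (full P) ≢Y)))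
    λ ()

  -- The last hypothesis is the symmetry of Q for the two ends of the diagonal, which are adjacent
  -- there. It forces Y′ to exhaust Q, and then both counts split into a factor for P and one for Q.
  Balanced-oneSided : All (Avoids Q) X → All (Avoids P) Y′ →
                      Balanced P X Y → Balanced Q [] Y′ → Balanced (P ++ Q) X (Y ++ Y′)
  Balanced-oneSided {Q} {X} {P} {Y′} {Y} X∉Q Y′∉P bal sat .balance e
    with Complementary-++⁻ {P = P} e
  ... | c , d , c′ , d′ , refl , refl , e₁ , e₂ = begin
    count X (++⁺ c d)
      ≡⟨ count-↭ (↭-reflexive (sym (++-identityʳ X))) (++⁺ c d) ⟩
    count (X ++ []) (++⁺ c d)
      ≡⟨ count-mixed X∉Q [] c d ⟩
    count X c * count [] d
      ≡⟨ cong₂ _*_ (bal .balance e₁) (sat .balance e₂) ⟩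
    count Y c′ * count Y′ d′
      ≡⟨ count-saturated Y Y′∉P c′ d′ (Balanced-saturated sat (Complementary-sym e₂)) ⟨
    count (Y ++ Y′) (++⁺ c′ d′)
      ∎
    where open ≡-Reasoning

  -- X and Y join the endpoints of the walk to u, X′ and Y′ join them to v. So `b₁` and `b₃` are
  -- symmetries between an endpoint and u, `b₂` and `b₄` between an endpoint and v; in each, one arc
  -- passes the other end of the diagonal.
  Balanced-crossing : ∀ {u v} → All (Avoids Q) X → All (Avoids Q) X′ →
    All (Avoids P) Y → All (Avoids P) Y′ →
    Balanced P X (v ∷ X′) → Balanced P (u ∷ X) X′ →
    Balanced Q Y (v ∷ Y′) → Balanced Q (u ∷ Y) Y′ →
    Balanced (P ++ Q) (u ∷ X ++ Y) (v ∷ X′ ++ Y′)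
  Balanced-crossing {Q} {X} {X′} {P} {Y} {Y′} {u} {v} X∉Q X′∉Q Y∉P Y′∉P b₁ b₂ b₃ b₄ .balance e
    with Complementary-++⁻ {P = P} e
  ... | c , d , c′ , d′ , refl , refl , e₁ , e₂ = begin
    count (u ∷ X ++ Y) (++⁺ c d)
      ≡⟨ count-shared u X∉Q Y∉P c d ⟩
    count (u ∷ X) c * count Y d + count X c * count (u ∷ Y) d
      ≡⟨ cong₂ _+_ (cong₂ _*_ (b₂ .balance e₁) (b₃ .balance e₂))
                   (cong₂ _*_ (b₁ .balance e₁) (b₄ .balance e₂)) ⟩
    count X′ c′ * count (v ∷ Y′) d′ + count (v ∷ X′) c′ * count Y′ d′
      ≡⟨ +-comm (count X′ c′ * _) _ ⟩
    count (v ∷ X′) c′ * count Y′ d′ + count X′ c′ * count (v ∷ Y′) d′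
      ≡⟨ count-shared v X′∉Q Y′∉P c′ d′ ⟨
    count (v ∷ X′ ++ Y′) (++⁺ c′ d′)
      ∎
    where open ≡-Reasoning

-- Cutting along a diagonal

-- Positions rather than values are compared, so locating i and j relative to u and v becomes
-- pattern matching.
data Split {a} {A : Set a} (X : List A) (i : A) (Y Z : List A) (u : A) (W : List A) : Set a where
  before : ∀ R → Z ≡ X ++ i ∷ R → Y ≡ R ++ u ∷ W → Split X i Y Z u W
  same   : X ≡ Z → i ≡ u → Y ≡ W → Split X i Y Z u W
  after  : ∀ R → X ≡ Z ++ u ∷ R → W ≡ R ++ i ∷ Y → Split X i Y Z u W

split : ∀ {a} {A : Set a} X {i : A} {Y} Z {u W} → X ++ i ∷ Y ≡ Z ++ u ∷ W → Split X i Y Z u W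
split []      []      refl = same refl refl refl
split []      (z ∷ Z) refl = before Z refl refl
split (x ∷ X) []      refl = after X refl refl
split (x ∷ X) (z ∷ Z) eq with ∷-injective eq
... | refl , eq′ with split X Z eq′
... | before R refl refl    = before R refl refl
... | same refl refl refl   = same refl refl refl
... | after R refl refl     = after R refl refl

module _ {n : ℕ} where

  -- V lists the vertices of a polygon in order, so that the vertices passed on
  -- the way from j back to i are those in X₂ ++ X₀.
  WalkSymmetric : List (Subset n) → List (Fin n) → Set
  WalkSymmetric P V = ∀ {X₀ i X₁ j X₂} → V ≡ X₀ ++ i ∷ X₁ ++ j ∷ X₂ → Balanced P X₁ (X₂ ++ X₀)

  module _ {P Q : List (Subset n)} {A₀ A₁ A₂ u v}
           (A₁∉Q : All (Avoids Q) A₁) (A₀∉P : All (Avoids P) A₀) (A₂∉P : All (Avoids P) A₂)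
           (symP : WalkSymmetric P (u ∷ A₁ ++ v ∷ []))
           (symQ : WalkSymmetric Q (A₀ ++ u ∷ v ∷ A₂)) where

    open import Algebra.Solver.CommutativeMonoid (++-commutativeMonoid {A = Fin n})
      using (solve; _⊜_; _⊕_) renaming (id to ε)

    private
      sideP : ∀ {X Y Z} → All (Avoids Q) X → Balanced P X Y → Y ++ A₂ ++ A₀ ↭ Z →
              Balanced (P ++ Q) X Z
      sideP X∉Q bal p = Balanced-↭ ↭-refl p
        -- In Q the walk from u to v is empty, and the reverse one, `A₂ ++ A₀`, is everything beyond
        -- the diagonal.
        (Balanced-oneSided X∉Q (++⁺ A₂∉P A₀∉P) bal (symQ {A₀} {u} {[]} refl))

      sideQ : ∀ {X Y Z} → All (Avoids P) X → Balanced Q X Y → Y ++ A₁ ↭ Z →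
              Balanced (P ++ Q) X Z
      sideQ X∉P bal p = Balanced-↭ ↭-refl p
        (Balanced-swap {P = Q} (Balanced-oneSided X∉P A₁∉Q bal
          -- In P the empty walk is the one from v, the last vertex, to u, the first.
          (Balanced-sym (symP {[]} {u} {A₁} refl))))

    -- An endpoint equal to u or v belongs to both parts and is treated in a part that contains the
    -- other endpoint. Strictly separated endpoints occur in two cases only, those using
    -- `Balanced-crossing`.
    glue : WalkSymmetric (P ++ Q) (A₀ ++ u ∷ A₁ ++ v ∷ A₂)
    glue {X₀} {i} {X₁} {j} {X₂} eq = position (split X₀ A₀ (sym eq))
      where
      assoc₁ : ∀ X {x : Fin n} {Y Z} → (X ++ x ∷ Y) ++ Z ≡ X ++ x ∷ Y ++ Z
      assoc₁ X = ++-assoc X _ _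

      assoc₂ : ∀ X {x : Fin n} Y {y Z W} →
               (X ++ x ∷ Y ++ y ∷ Z) ++ W ≡ X ++ x ∷ Y ++ y ∷ Z ++ W
      assoc₂ X {x} Y = ≡.trans (++-assoc X _ _) (cong (λ Z → X ++ x ∷ Z) (++-assoc Y _ _))

      assoc₃ : ∀ X {x : Fin n} Y Z {W} → (X ++ x ∷ Y) ++ Z ++ W ≡ X ++ x ∷ (Y ++ Z) ++ W
      assoc₃ X {x} Y Z =
        ≡.trans (++-assoc X _ _) (cong (λ V → X ++ x ∷ V) (sym (++-assoc Y Z _)))

      position : Split X₀ i (X₁ ++ j ∷ X₂) A₀ u (A₁ ++ v ∷ A₂) →
                 Balanced (P ++ Q) X₁ (X₂ ++ X₀)
      position (before R refl eq) with split X₁ R eq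
      ... | before R′ refl refl =
        sideQ (++⁻ˡ X₁ (drop-∷ (++⁻ʳ X₀ A₀∉P))) (symQ {X₀} {i} {X₁} (assoc₂ X₀ X₁))
          (solve 6 (λ r u a v b x → ((r ⊕ u ⊕ v ⊕ b) ⊕ x) ⊕ a ⊜ (r ⊕ u ⊕ a ⊕ v ⊕ b) ⊕ x)
            ↭-refl R′ (u ∷ []) A₁ (v ∷ []) A₂ X₀)
      ... | same refl refl refl =
        sideQ (drop-∷ (++⁻ʳ X₀ A₀∉P)) (symQ {X₀} {i} {X₁} (assoc₁ X₀))
          (solve 4 (λ a v b x → ((v ⊕ b) ⊕ x) ⊕ a ⊜ (a ⊕ v ⊕ b) ⊕ x)
            ↭-refl A₁ (v ∷ []) A₂ X₀)
      ... | after T refl eq′ with split T A₁ (sym eq′)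
      -- i in `A₀`, j in `A₁`: the walk passes u and the return passes v.
      ...   | before T′ refl refl = Balanced-↭
        (solve 3 (λ u t r → u ⊕ t ⊕ r ⊜ r ⊕ u ⊕ t) ↭-refl (u ∷ []) T R)
        (solve 4 (λ t v b x → v ⊕ t ⊕ b ⊕ x ⊜ (t ⊕ v ⊕ b) ⊕ x) ↭-refl T′ (v ∷ []) A₂ X₀)
        (Balanced-crossing (++⁻ˡ T A₁∉Q) (drop-∷ (++⁻ʳ T A₁∉Q))
          (drop-∷ (++⁻ʳ X₀ A₀∉P)) (++⁺ A₂∉P (++⁻ˡ X₀ A₀∉P))
          (Balanced-↭ ↭-refl
            (solve 2 (λ t v → (t ⊕ v) ⊕ ε ⊜ v ⊕ t) ↭-refl T′ (v ∷ []))
            (symP {[]} {u} {T} (cong (u ∷_) (assoc₁ T))))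
          (Balanced-sym (symP {u ∷ T} {j} {T′} (cong (u ∷_) (assoc₁ T))))
          (symQ {X₀} {i} {R} (assoc₁ X₀))
          (Balanced-↭
            (solve 2 (λ r u → r ⊕ u ⊜ u ⊕ r) ↭-refl R (u ∷ [])) ↭-refl
            (symQ {X₀} {i} {R ++ u ∷ []} (assoc₃ X₀ R (u ∷ [])))))
      -- With j at v or later the walk contains all of `A₁`, so it is the return that stays on the Q
      -- side.
      ...   | same refl refl refl = Balanced-sym
        (sideQ (++⁺ A₂∉P (++⁻ˡ X₀ A₀∉P))
          (Balanced-sym (symQ {X₀} {i} {R ++ u ∷ []} (assoc₃ X₀ R (u ∷ []))))
          (solve 3 (λ r u a → (r ⊕ u) ⊕ a ⊜ r ⊕ u ⊕ a) ↭-refl R (u ∷ []) A₁))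
      ...   | after T′ refl refl = Balanced-sym
        (sideQ (++⁺ (drop-∷ (++⁻ʳ T′ A₂∉P)) (++⁻ˡ X₀ A₀∉P))
          (Balanced-sym (symQ {X₀} {i} {R ++ u ∷ v ∷ T′} (assoc₃ X₀ R (u ∷ v ∷ T′))))
          (solve 5 (λ r u v t a → (r ⊕ u ⊕ v ⊕ t) ⊕ a ⊜ r ⊕ u ⊕ a ⊕ v ⊕ t)
            ↭-refl R (u ∷ []) (v ∷ []) T′ A₁))
      position (same refl refl eq) with split X₁ A₁ eq
      ... | before T refl refl =
        sideP (++⁻ˡ X₁ A₁∉Q) (symP {[]} {u} {X₁} (cong (u ∷_) (assoc₁ X₁)))
          (solve 4 (λ t v b a → ((t ⊕ v) ⊕ ε) ⊕ b ⊕ a ⊜ (t ⊕ v ⊕ b) ⊕ a)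
            ↭-refl T (v ∷ []) A₂ A₀)
      ... | same refl refl refl = sideP A₁∉Q (symP {[]} {u} {A₁} refl) ↭-refl
      ... | after T refl refl = Balanced-sym
        (sideQ (++⁺ (drop-∷ (++⁻ʳ T A₂∉P)) A₀∉P)
          (Balanced-sym (symQ {A₀} {u} {v ∷ T} refl))
          (solve 3 (λ v t a → (v ⊕ t) ⊕ a ⊜ a ⊕ v ⊕ t) ↭-refl (v ∷ []) T A₁))
      position (after R refl eq) with split R A₁ (sym eq)
      ... | same refl refl refl =
        sideQ (++⁻ˡ X₁ A₂∉P) (symQ {A₀ ++ u ∷ []} {v} {X₁} (sym (++-assoc A₀ _ _)))
          (solve 4 (λ x a₀ u a₁ → (x ⊕ a₀ ⊕ u) ⊕ a₁ ⊜ x ⊕ a₀ ⊕ u ⊕ a₁)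
            ↭-refl X₂ A₀ (u ∷ []) A₁)
      ... | after T refl refl =
        sideQ (++⁻ˡ X₁ (drop-∷ (++⁻ʳ T A₂∉P)))
          (symQ {A₀ ++ u ∷ v ∷ T} {i} {X₁} (sym (++-assoc A₀ _ _)))
          (solve 6 (λ x a₀ u v t a₁ →
              (x ⊕ a₀ ⊕ u ⊕ v ⊕ t) ⊕ a₁ ⊜ x ⊕ a₀ ⊕ u ⊕ a₁ ⊕ v ⊕ t)
            ↭-refl X₂ A₀ (u ∷ []) (v ∷ []) T A₁)
      ... | before T refl eq′ with split X₁ T eq′
      ...   | before T′ refl refl =
        sideP (++⁻ˡ X₁ (drop-∷ (++⁻ʳ R A₁∉Q)))
          (symP {u ∷ R} {i} {X₁} (cong (u ∷_) (assoc₂ R X₁)))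
          (solve 6 (λ t v u r b a →
              ((t ⊕ v) ⊕ u ⊕ r) ⊕ b ⊕ a ⊜ (t ⊕ v ⊕ b) ⊕ a ⊕ u ⊕ r)
            ↭-refl T′ (v ∷ []) (u ∷ []) R A₂ A₀)
      ...   | same refl refl refl =
        sideP (drop-∷ (++⁻ʳ R A₁∉Q)) (symP {u ∷ R} {i} {T} (cong (u ∷_) (assoc₁ R)))
          (solve 4 (λ u r b a → (u ⊕ r) ⊕ b ⊕ a ⊜ b ⊕ a ⊕ u ⊕ r) ↭-refl (u ∷ []) R A₂ A₀)
      -- i in `A₁`, j in `A₂`: now the walk passes v and the return u, so u and v exchange roles.
      ...   | after T′ refl refl = Balanced-↭
        (solve 3 (λ v t t′ → v ⊕ t ⊕ t′ ⊜ t ⊕ v ⊕ t′) ↭-refl (v ∷ []) T T′)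
        (solve 4 (λ u r x a → u ⊕ r ⊕ x ⊕ a ⊜ x ⊕ a ⊕ u ⊕ r) ↭-refl (u ∷ []) R X₂ A₀)
        (Balanced-crossing (drop-∷ (++⁻ʳ R A₁∉Q)) (++⁻ˡ R A₁∉Q)
          (++⁻ˡ T′ A₂∉P) (++⁺ (drop-∷ (++⁻ʳ T′ A₂∉P)) A₀∉P)
          (symP {u ∷ R} {i} {T} (cong (u ∷_) (assoc₁ R)))
          (Balanced-↭
            (solve 2 (λ t v → (t ⊕ v) ⊕ ε ⊜ v ⊕ t) ↭-refl T (v ∷ [])) ↭-refl
            (Balanced-sym (symP {[]} {u} {R} (cong (u ∷_) (assoc₁ R)))))
          (Balanced-↭ ↭-refl
            (solve 3 (λ x a u → x ⊕ a ⊕ u ⊜ u ⊕ x ⊕ a) ↭-refl X₂ A₀ (u ∷ []))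
            (symQ {A₀ ++ u ∷ []} {v} {T′} (sym (++-assoc A₀ _ _))))
          (symQ {A₀} {u} {v ∷ T′} refl))

-- Kronecker delta, the coefficient of x^a in x^b.
indicator : ℕ → ℕ → ℕ
indicator zero    zero    = 1
indicator (suc a) (suc b) = indicator a b
indicator _       _       = 0

indicator-refl : ∀ a → indicator a a ≡ 1
indicator-refl zero    = refl
indicator-refl (suc a) = indicator-refl a

indicator-≢ : ∀ a b → a ≢ b → indicator a b ≡ 0
indicator-≢ zero    zero    a≢b = contradiction refl a≢b
indicator-≢ zero    (suc b) a≢b = refl
indicator-≢ (suc a) zero    a≢b = refl
indicator-≢ (suc a) (suc b) a≢b = indicator-≢ a b (a≢b ∘ cong suc)

indicator-complement : ∀ a b x y → a + b ≡ x + y → indicator a x ≡ indicator b y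
indicator-complement a b x y eq with a ≟ x
... | yes refl rewrite +-cancelˡ-≡ a b y eq =
  ≡.trans (indicator-refl a) (sym (indicator-refl y))
... | no a≢x   = ≡.trans (indicator-≢ a x a≢x) (sym (indicator-≢ b y b≢y))
  where
  b≢y : b ≢ y
  b≢y refl = a≢x (+-cancelʳ-≡ b a x eq)

does≡true⇒ : ∀ {A : Set} (A? : Dec A) → does A? ≡ true → A
does≡true⇒ (yes a) refl = a

length-filter-map : ∀ {A B : Set} {P : Pred B 0ℓ} (P? : Decidable P) (f : A → B) xs →
                    length (filter P? (map f xs)) ≡ length (filter (P? ∘ f) xs)
length-filter-map P? f []       = refl
length-filter-map P? f (x ∷ xs) with does (P? (f x))
... | true  = cong suc (length-filter-map P? f xs)
... | false = length-filter-map P? f xs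

-- Vertex lists of the two sides of a diagonal

module _ {n : ℕ} where

  vertices : Subset n → List (Fin n)
  vertices S = filter (_∈? S) (allFin n)

  ∈-tabulate⁺ : ∀ {P : Pred (Fin n) 0ℓ} (P? : Decidable P) {k} →
                P k → k ∈ Vec.tabulate (does ∘ P?)
  ∈-tabulate⁺ P? {k} p =
    Vec.lookup⇒[]= k _ (≡.trans (Vec.lookup∘tabulate _ k) (dec-true (P? k) p))

  ∈-tabulate⁻ : ∀ {P : Pred (Fin n) 0ℓ} (P? : Decidable P) {k} →
                k ∈ Vec.tabulate (does ∘ P?) → P k
  ∈-tabulate⁻ P? {k} k∈ =
    does≡true⇒ (P? k) (≡.trans (sym (Vec.lookup∘tabulate _ k)) (Vec.[]=⇒lookup k∈))

  sorted-split : ∀ {V : List (Fin n)} {u} → AllPairs Fin._<_ V → u List.∈ V →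
    ∃[ X ] ∃[ Y ] V ≡ X ++ u ∷ Y × All (Fin._< u) X × All (u Fin.<_) Y × AllPairs Fin._<_ Y
  sorted-split (u<Y ∷ Y↗) (here refl) = [] , _ , refl , [] , u<Y , Y↗
  sorted-split (x<V ∷ V↗) (there u∈V) with sorted-split V↗ u∈V
  ... | X , Y , refl , X<u , u<Y , Y↗ =
    _ ∷ X , Y , refl , All.lookup x<V u∈V ∷ X<u , u<Y , Y↗

  -- Labels increase along V, so the comparisons that define `inner` and `outer` cut it into
  -- consecutive blocks.
  record SortedSplit (V : List (Fin n)) (u v : Fin n) : Set where
    field
      {X₀ X₁ X₂} : List (Fin n)
      split≡     : V ≡ X₀ ++ u ∷ X₁ ++ v ∷ X₂
      X₀<u       : All (Fin._< u) X₀
      u<X₁       : All (u Fin.<_) X₁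
      X₁<v       : All (Fin._< v) X₁
      v<X₂       : All (v Fin.<_) X₂

  sorted-split₂ : ∀ {V : List (Fin n)} {u v} → AllPairs Fin._<_ V → u List.∈ V → v List.∈ V →
                  u Fin.< v → SortedSplit V u v
  sorted-split₂ {u = u} {v} V↗ u∈V v∈V u<v with sorted-split V↗ u∈V
  ... | X₀ , Y , refl , X₀<u , u<Y , Y↗ with sorted-split Y↗ v∈Y
    where
    v∈Y : v List.∈ Y
    v∈Y with ∈-++⁻ X₀ v∈V
    ... | inj₁ v∈X₀         = contradiction (All.lookup X₀<u v∈X₀) (<-asym u<v)
    ... | inj₂ (here refl)  = contradiction u<v (<-irrefl refl)
    ... | inj₂ (there v∈Y)  = v∈Y
  ... | X₁ , X₂ , refl , X₁<v , v<X₂ , _ = record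
    { split≡ = refl ; X₀<u = X₀<u ; u<X₁ = ++⁻ˡ X₁ u<Y ; X₁<v = X₁<v ; v<X₂ = v<X₂ }

  allFin-sorted : AllPairs Fin._<_ (allFin n)
  allFin-sorted = AllPairs.tabulate⁺-< id

  vertices-∩ : ∀ S T → vertices (S ∩ T) ≡ filter (_∈? T) (vertices S)
  vertices-∩ S T = filter-∩ (allFin n)
    where
    filter-∩ : ∀ V → filter (_∈? (S ∩ T)) V ≡ filter (_∈? T) (filter (_∈? S) V)
    filter-∩ []      = refl
    filter-∩ (k ∷ V) with k ∈? S | k ∈? T
    ... | no k∉S  | _       = ≡.trans
      (filter-reject (_∈? (S ∩ T)) (k∉S ∘ proj₁ ∘ x∈p∩q⁻ S T)) (filter-∩ V)
    ... | yes k∈S | no k∉T  = ≡.trans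
      (filter-reject (_∈? (S ∩ T)) (k∉T ∘ proj₂ ∘ x∈p∩q⁻ S T))
      (≡.trans (filter-∩ V) (sym (filter-reject (_∈? T) k∉T)))
    ... | yes k∈S | yes k∈T = ≡.trans
      (filter-accept (_∈? (S ∩ T)) (x∈p∩q⁺ (k∈S , k∈T)))
      (≡.trans (cong (k ∷_) (filter-∩ V)) (sym (filter-accept (_∈? T) k∈T)))

  module _ {S : Subset n} {u v : Fin n} (u<v : u Fin.< v) (s : SortedSplit (vertices S) u v) where
    open SortedSplit s

    private
      I? : Decidable (_∈ inner (u , v))
      I? = _∈? inner (u , v)

      O? : Decidable (_∈ outer (u , v))
      O? = _∈? outer (u , v)

      inner⁺ : ∀ {k} → u Fin.≤ k → k Fin.≤ v → k ∈ inner (u , v)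
      inner⁺ u≤k k≤v = ∈-tabulate⁺ (λ k → (u Fin.≤? k) ×-dec (k Fin.≤? v)) (u≤k , k≤v)

      inner⁻ : ∀ {k} → k ∈ inner (u , v) → u Fin.≤ k × k Fin.≤ v
      inner⁻ = ∈-tabulate⁻ (λ k → (u Fin.≤? k) ×-dec (k Fin.≤? v))

      outer⁺ : ∀ {k} → k Fin.≤ u ⊎ v Fin.≤ k → k ∈ outer (u , v)
      outer⁺ = ∈-tabulate⁺ (λ k → (k Fin.≤? u) ⊎-dec (v Fin.≤? k))

      outer⁻ : ∀ {k} → k ∈ outer (u , v) → k Fin.≤ u ⊎ v Fin.≤ k
      outer⁻ = ∈-tabulate⁻ (λ k → (k Fin.≤? u) ⊎-dec (v Fin.≤? k))

      u<X₁<v : All (λ k → u Fin.< k × k Fin.< v) X₁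
      u<X₁<v = All.zip (u<X₁ , X₁<v)

    X₀∉inner : All (_∉ inner (u , v)) X₀
    X₀∉inner = All.map (λ k<u k∈ → <⇒≱ k<u (proj₁ (inner⁻ k∈))) X₀<u

    X₂∉inner : All (_∉ inner (u , v)) X₂
    X₂∉inner = All.map (λ v<k k∈ → <⇒≱ v<k (proj₂ (inner⁻ k∈))) v<X₂

    X₁∉outer : All (_∉ outer (u , v)) X₁
    X₁∉outer = All.map (λ (u<k , k<v) k∈ → [ <⇒≱ u<k , <⇒≱ k<v ]′ (outer⁻ k∈)) u<X₁<v

    vertices-inner : vertices (S ∩ inner (u , v)) ≡ u ∷ X₁ ++ v ∷ []
    vertices-inner = begin
      vertices (S ∩ inner (u , v))
        ≡⟨ vertices-∩ S _ ⟩
      filter I? (vertices S)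
        ≡⟨ cong (filter I?) split≡ ⟩
      filter I? (X₀ ++ u ∷ X₁ ++ v ∷ X₂)
        ≡⟨ filter-++ I? X₀ _ ⟩
      filter I? X₀ ++ filter I? (u ∷ X₁ ++ v ∷ X₂)
        ≡⟨ cong₂ _++_ (filter-none I? X₀∉inner) (filter-accept I? (inner⁺ ≤-refl (<⇒≤ u<v))) ⟩
      u ∷ filter I? (X₁ ++ v ∷ X₂)
        ≡⟨ cong (u ∷_) (filter-++ I? X₁ _) ⟩
      u ∷ filter I? X₁ ++ filter I? (v ∷ X₂)
        ≡⟨ cong₂ (λ Y Z → u ∷ Y ++ Z) (filter-all I? X₁∈inner)
             (filter-accept I? (inner⁺ (<⇒≤ u<v) ≤-refl)) ⟩
      u ∷ X₁ ++ v ∷ filter I? X₂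
        ≡⟨ cong (λ Y → u ∷ X₁ ++ v ∷ Y) (filter-none I? X₂∉inner) ⟩
      u ∷ X₁ ++ v ∷ []
        ∎
      where
      open ≡-Reasoning
      X₁∈inner : All (_∈ inner (u , v)) X₁
      X₁∈inner = All.map (λ (u<k , k<v) → inner⁺ (<⇒≤ u<k) (<⇒≤ k<v)) u<X₁<v

    vertices-outer : vertices (S ∩ outer (u , v)) ≡ X₀ ++ u ∷ v ∷ X₂
    vertices-outer = begin
      vertices (S ∩ outer (u , v))
        ≡⟨ vertices-∩ S _ ⟩
      filter O? (vertices S)
        ≡⟨ cong (filter O?) split≡ ⟩
      filter O? (X₀ ++ u ∷ X₁ ++ v ∷ X₂)
        ≡⟨ filter-++ O? X₀ _ ⟩
      filter O? X₀ ++ filter O? (u ∷ X₁ ++ v ∷ X₂)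
        ≡⟨ cong₂ _++_ (filter-all O? (All.map (outer⁺ ∘ inj₁ ∘ <⇒≤) X₀<u))
             (filter-accept O? (outer⁺ (inj₁ ≤-refl))) ⟩
      X₀ ++ u ∷ filter O? (X₁ ++ v ∷ X₂)
        ≡⟨ cong (λ Y → X₀ ++ u ∷ Y) (filter-++ O? X₁ _) ⟩
      X₀ ++ u ∷ filter O? X₁ ++ filter O? (v ∷ X₂)
        ≡⟨ cong₂ (λ Y Z → X₀ ++ u ∷ Y ++ Z) (filter-none O? X₁∉outer)
             (filter-accept O? (outer⁺ (inj₂ ≤-refl))) ⟩
      X₀ ++ u ∷ v ∷ filter O? X₂
        ≡⟨ cong (λ Y → X₀ ++ u ∷ v ∷ Y) (filter-all O? (All.map (outer⁺ ∘ inj₂ ∘ <⇒≤) v<X₂)) ⟩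
      X₀ ++ u ∷ v ∷ X₂
        ∎
      where
      open ≡-Reasoning

  cut-⊆ : ∀ (es : List (Chord n)) S → All (_⊆ S) (cut es S)
  cut-⊆ []             S = ⊆-refl ∷ []
  cut-⊆ ((u , v) ∷ es) S with u ∈? S | v ∈? S
  ... | yes _ | yes _ = ++⁺
    (weaken (cut-⊆ es (S ∩ inner (u , v))))
    (weaken (cut-⊆ es (S ∩ outer (u , v))))
    where
    weaken : ∀ {T P} → All (_⊆ (S ∩ T)) P → All (_⊆ S) P
    weaken []         = []
    weaken (p⊆ ∷ P⊆) = (λ k∈p → p∩q⊆p S _ (p⊆ k∈p)) ∷ weaken P⊆
  ... | yes _ | no _  = cut-⊆ es S
  ... | no _  | _     = cut-⊆ es S

  -- Cutting only shrinks vertex sets, so pieces of `S ∩ T` stay within T.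
  cut-avoids : ∀ (es : List (Chord n)) {S T : Subset n} {V} → All (_∉ T) V →
               All (Avoids (cut es (S ∩ T))) V
  cut-avoids es {S} {T} = All.map λ k∉T → avoids k∉T (cut-⊆ es (S ∩ T))
    where
    avoids : ∀ {k} {P : List (Subset n)} → k ∉ T → All (_⊆ (S ∩ T)) P → Avoids P k
    avoids k∉T []        = []
    avoids k∉T (p⊆ ∷ P⊆) = (λ k∈p → k∉T (proj₂ (x∈p∩q⁻ S T (p⊆ k∈p)))) ∷ avoids k∉T P⊆

  -- With a single piece every linear form is its variable x, and the product is x^(length X).
  count-single : ∀ {S : Subset n} {X} → All (_∈ S) X → ∀ a →
                 count {P = S ∷ []} X (a ∷ []) ≡ indicator a (length X)
  count-single []           zero    = refl
  count-single []           (suc a) = refl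
  count-single {S} {k ∷ X} (k∈S ∷ X∈S) a rewrite dec-true (k ∈? S) k∈S with a
  ... | zero  = refl
  ... | suc a = ≡.trans (+-identityʳ _) (count-single X∈S a)

∣S∣≡length : ∀ {n} (S : Subset n) → length (vertices S) ≡ ∣ S ∣
∣S∣≡length {zero}  Vec.[]       = refl
∣S∣≡length {suc n} (b Vec.∷ S) = bySide b
  where
  open ≡-Reasoning
  tail : ∀ b → length (filter (_∈? (b Vec.∷ S)) (tabulate suc)) ≡ ∣ S ∣
  tail b = begin
    length (filter (_∈? (b Vec.∷ S)) (tabulate suc))
      ≡⟨ cong (length ∘ filter (_∈? (b Vec.∷ S))) (map-tabulate id suc) ⟨
    length (filter (_∈? (b Vec.∷ S)) (map suc (allFin n)))
      ≡⟨ length-filter-map (_∈? (b Vec.∷ S)) suc (allFin n) ⟩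
    length (filter (λ k → suc k ∈? (b Vec.∷ S)) (allFin n))
      ≡⟨ cong length (filter-≐ (λ k → suc k ∈? (b Vec.∷ S)) (_∈? S)
           (drop-there , Vec.there) (allFin n)) ⟩
    length (vertices S)
      ≡⟨ ∣S∣≡length S ⟩
    ∣ S ∣
      ∎
  bySide : ∀ b → length (vertices (b Vec.∷ S)) ≡ ∣ b Vec.∷ S ∣
  bySide true  = cong suc (tail true)
  bySide false = tail false

-- S varies because the remaining diagonals cut each side further. In an undissected polygon with d
-- vertices the two directions together pass all vertices but i and j, which is where d - 2 comes
-- from.
walkSymmetric : ∀ {n} es → All (λ (u , v) → u Fin.< v) es → (S : Subset n) →
                WalkSymmetric (cut es S) (vertices S)
walkSymmetric [] [] S {X₀} {i} {X₁} {j} {X₂} eq .balance {a ∷ []} {b ∷ []} (a+b ∷ []) = begin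
  count X₁ (a ∷ [])
    ≡⟨ count-single X₁∈S a ⟩
  indicator a (length X₁)
    ≡⟨ indicator-complement a b _ _ lengths ⟩
  indicator b (length (X₂ ++ X₀))
    ≡⟨ count-single (++⁺ X₂∈S X₀∈S) b ⟨
  count (X₂ ++ X₀) (b ∷ [])
    ∎
  where
  open ≡-Reasoning
  V∈S : All (_∈ S) (X₀ ++ i ∷ X₁ ++ j ∷ X₂)
  V∈S = subst (All (_∈ S)) eq (all-filter (_∈? S) (allFin _))
  X₀∈S = ++⁻ˡ X₀ V∈S
  X₁∈S = ++⁻ˡ X₁ (drop-∷ (++⁻ʳ X₀ V∈S))
  X₂∈S = drop-∷ (++⁻ʳ X₁ (drop-∷ (++⁻ʳ X₀ V∈S)))
  lengths : a + b ≡ length X₁ + length (X₂ ++ X₀)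
  lengths = begin
    a + b
      ≡⟨ a+b ⟩
    ∣ S ∣ ∸ 2
      ≡⟨ cong (_∸ 2) (≡.trans (sym (∣S∣≡length S)) (cong length eq)) ⟩
    length (X₀ ++ i ∷ X₁ ++ j ∷ X₂) ∸ 2
      -- With i and j moved to the front, `∸ 2` removes exactly these two.
      ≡⟨ cong (_∸ 2) (↭-length (solve 5
           (λ x i y j z → x ⊕ i ⊕ y ⊕ j ⊕ z ⊜ i ⊕ j ⊕ y ⊕ z ⊕ x)
           ↭-refl X₀ (i ∷ []) X₁ (j ∷ []) X₂)) ⟩
    length (X₁ ++ X₂ ++ X₀)
      ≡⟨ length-++ X₁ ⟩
    length X₁ + length (X₂ ++ X₀)
      ∎
    where
    open import Algebra.Solver.CommutativeMonoid (++-commutativeMonoid {A = Fin _})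
      using (solve; _⊜_; _⊕_)
walkSymmetric ((u , v) ∷ es) (u<v ∷ <es) S with u ∈? S | v ∈? S
... | yes u∈S | yes v∈S = subst (WalkSymmetric (P ++ Q)) (sym split≡)
  (glue (cut-avoids es (X₁∉outer u<v s))
    (cut-avoids es (X₀∉inner u<v s)) (cut-avoids es (X₂∉inner u<v s))
    (subst (WalkSymmetric P) (vertices-inner u<v s) (walkSymmetric es <es _))
    (subst (WalkSymmetric Q) (vertices-outer u<v s) (walkSymmetric es <es _)))
  where
  P = cut es (S ∩ inner (u , v))
  Q = cut es (S ∩ outer (u , v))
  s : SortedSplit (vertices S) u v
  s = sorted-split₂ (AllPairs.filter⁺ (_∈? S) allFin-sorted)
    (∈-filter⁺ (_∈? S) (∈-allFin u) u∈S) (∈-filter⁺ (_∈? S) (∈-allFin v) v∈S) u<v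
  open SortedSplit s
... | yes _ | no _ = walkSymmetric es <es S
... | no _  | _    = walkSymmetric es <es S

-- Walks and coefficients

private variable
  A B : Set
  m n : ℕ

length-filter-filter : ∀ {P Q : Pred A 0ℓ} (P? : Decidable P) (Q? : Decidable Q) xs →
  length (filter Q? (filter P? xs)) ≡ length (filter (λ x → P? x ×-dec Q? x) xs)
length-filter-filter P? Q? []       = refl
length-filter-filter P? Q? (x ∷ xs) with does (P? x)
... | false = length-filter-filter P? Q? xs
... | true with does (Q? x)
...   | true  = cong suc (length-filter-filter P? Q? xs)
...   | false = length-filter-filter P? Q? xs

length-filter-none : ∀ {P : Pred A 0ℓ} (P? : Decidable P) → (∀ x → ¬ P x) → ∀ xs →
                     length (filter P? xs) ≡ 0
length-filter-none P? ¬P xs = cong length (filter-none P? (All.universal ¬P xs))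

length-filter-cartesianProductWith : ∀ {C : Set} {P : Pred C 0ℓ} (P? : Decidable P)
  (f : A → B → C) xs ys → length (filter P? (cartesianProductWith f xs ys)) ≡
  sum (map (λ x → length (filter (P? ∘ f x) ys)) xs)
length-filter-cartesianProductWith P? f []       ys = refl
length-filter-cartesianProductWith P? f (x ∷ xs) ys = begin
  length (filter P? (map (f x) ys ++ cartesianProductWith f xs ys))
    ≡⟨ cong length (filter-++ P? (map (f x) ys) _) ⟩
  length (filter P? (map (f x) ys) ++ filter P? (cartesianProductWith f xs ys))
    ≡⟨ length-++ (filter P? (map (f x) ys)) ⟩
  length (filter P? (map (f x) ys)) + length (filter P? (cartesianProductWith f xs ys))
    ≡⟨ cong₂ _+_ (length-filter-map P? (f x) ys)
         (length-filter-cartesianProductWith P? f xs ys) ⟩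
  length (filter (P? ∘ f x) ys) + sum (map (λ x → length (filter (P? ∘ f x) ys)) xs)
    ∎
  where open ≡-Reasoning

coeff-map : ∀ (g : A → Monomial m n) xs μ →
            coeff (map (λ x → 1ℤ , g x) xs) μ ≡ ℤ.+ length (filter (λ x → g x ≟ᴹ μ) xs)
coeff-map g []       μ = refl
coeff-map g (x ∷ xs) μ with does (g x ≟ᴹ μ)
... | true  = cong (λ c → 1ℤ ℤ.+ c) (coeff-map g xs μ)
... | false = coeff-map g xs μ

∏-∷ : ∀ (l : Fin m) w → ∏ (l ∷ w) ≡ ∏ w [ l ]%= suc
∏-∷ {m} l w = begin
  Vec.tabulate (λ s → occurrences s (l ∷ w))
    ≡⟨ Vec.tabulate-cong pointwise ⟩
  Vec.tabulate (Vec.lookup (∏ w [ l ]%= suc))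
    ≡⟨ Vec.tabulate∘lookup _ ⟩
  ∏ w [ l ]%= suc
    ∎
  where
  open ≡-Reasoning
  pointwise : ∀ s → occurrences s (l ∷ w) ≡ Vec.lookup (∏ w [ l ]%= suc) s
  pointwise s with s Fin.≟ l
  ... | yes refl = sym (≡.trans (Vec.lookup∘updateAt s (∏ w)) (cong suc (Vec.lookup∘tabulate _ s)))
  ... | no s≢l   = sym (≡.trans (Vec.lookup∘updateAt′ s l s≢l (∏ w)) (Vec.lookup∘tabulate _ s))

-- Together with `≡-increment` this matches the words of content x beginning with l to the words of
-- content x lowered at l.
increment-≡ : ∀ {x : Vec ℕ m} (y : Vec ℕ m) l {b} → Vec.lookup x l ≡ suc b →
              y [ l ]%= suc ≡ x → y ≡ x [ l ]≔ b
increment-≡ y l {b} eq refl = sym (≡.trans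
  (Vec.updateAt-updateAt l y)
  (Vec.updateAt-id-local l y
    (sym (suc-injective (≡.trans (sym (Vec.lookup∘updateAt l y)) eq)))))

≡-increment : ∀ (x : Vec ℕ m) {y : Vec ℕ m} l {b} → Vec.lookup x l ≡ suc b →
              y ≡ x [ l ]≔ b → y [ l ]%= suc ≡ x
≡-increment x l eq refl = ≡.trans (Vec.updateAt-updateAt l x) (Vec.updateAt-id-local l x (sym eq))

module _ {n : ℕ} where

  toContent : ∀ P → Vec ℕ (length P) → Content {n} P
  toContent []      []      = []
  toContent (p ∷ P) (a ∷ x) = a ∷ toContent P x

  toContent-complementary : ∀ P x y →
    (∀ l → Vec.lookup x l + Vec.lookup y l ≡ ∣ lookup P l ∣ ∸ 2) →
    Complementary (toContent P x) (toContent P y)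
  toContent-complementary []      []      []      eq = []
  toContent-complementary (p ∷ P) (a ∷ x) (b ∷ y) eq =
    eq zero ∷ toContent-complementary P x y (eq ∘ suc)

  summand : ∀ P → Fin n → (Content P → ℕ) → Vec ℕ (length P) → Fin (length P) → ℕ
  summand P k f x l =
    lowerIf (does (k ∈? lookup P l)) (λ b → f (toContent P (x [ l ]≔ b))) (Vec.lookup x l)

  step-toContent : ∀ P k (f : Content P → ℕ) x →
                   sum (tabulate (summand P k f x)) ≡ step k f (toContent P x)
  step-toContent []      k f []      = refl
  step-toContent (p ∷ P) k f (a ∷ x) =
    cong₂ _+_ refl (step-toContent P k (λ d → f (a ∷ d)) x)

  module _ (P : List (Subset n)) where

    -- The content is prescribed instead of bounded; for distinct endpoints and x within the bounds
    -- these are the walks of content x.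
    Fits : List (Fin n) → Vec ℕ (length P) → List (Fin (length P)) → Set
    Fits ks x w = Pointwise (λ k p → k ∈ lookup P p) ks w × ∏ w ≡ x

    fits? : ∀ ks x w → Dec (Fits ks x w)
    fits? ks x w =
      Pointwise.decidable (λ k p → k ∈? lookup P p) ks w ×-dec Vec.≡-dec _≟_ (∏ w) x

    -- Sorting words by their first letter reproduces the recursion of `count`, since `step` sums
    -- over the piece taken by the first vertex.
    words-count : ∀ ks x → length (filter (fits? ks x) (words (length P) (length ks))) ≡
                  count ks (toContent P x)
    words-count [] x with Vec.≡-dec _≟_ (∏ []) x
    ... | yes refl = sym (isZero-zero P)
      where
      isZero-zero : ∀ P → isZero (toContent P (∏ [])) ≡ 1
      isZero-zero []      = refl
      isZero-zero (p ∷ P) = isZero-zero P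
    ... | no ∏≢x   = sym (isZero-nonzero P x ∏≢x)
      where
      isZero-nonzero : ∀ P x → ∏ [] ≢ x → isZero (toContent P x) ≡ 0
      isZero-nonzero []      []          ≢x = contradiction refl ≢x
      isZero-nonzero (p ∷ P) (zero ∷ x)  ≢x = isZero-nonzero P x (≢x ∘ cong (0 ∷_))
      isZero-nonzero (p ∷ P) (suc _ ∷ x) ≢x = refl
    words-count (k ∷ ks) x = begin
      length (filter (fits? (k ∷ ks) x) (words (length P) (suc (length ks))))
        ≡⟨ length-filter-cartesianProductWith (fits? (k ∷ ks) x) _∷_ (allFin (length P)) ws ⟩
      sum (map startingWith (allFin (length P)))
        ≡⟨ cong sum (map-tabulate id startingWith) ⟩
      sum (tabulate startingWith)
        ≡⟨ cong sum (tabulate-cong λ l → firstPiece l (fits? (k ∷ ks) x ∘ (l ∷_))) ⟩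
      sum (tabulate (summand P k (count ks) x))
        ≡⟨ step-toContent P k (count ks) x ⟩
      step k (count ks) (toContent P x)
        ∎
      where
      open ≡-Reasoning
      ws = words (length P) (length ks)
      startingWith : Fin (length P) → ℕ
      startingWith l = length (filter (fits? (k ∷ ks) x ∘ (l ∷_)) ws)
      -- `Q?` is arbitrary so that the case distinction on incidence leaves the filter untouched.
      firstPiece : ∀ l (Q? : Decidable (λ w → Fits (k ∷ ks) x (l ∷ w))) →
                   length (filter Q? ws) ≡ summand P k (count ks) x l
      firstPiece l Q? with k ∈? lookup P l
      ... | no k∉ = length-filter-none Q? (λ { _ (k∈ ∷ _ , _) → k∉ k∈ }) ws
      ... | yes k∈ with Vec.lookup x l in eq
      ...   | zero  = length-filter-none Q?
        (λ { w (_ , refl) → 0≢1+n (≡.trans (sym eq)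
          (≡.trans (cong (λ y → Vec.lookup y l) (∏-∷ l w)) (Vec.lookup∘updateAt l (∏ w)))) })
        ws
      ...   | suc b = ≡.trans
        (cong length (filter-≐ Q? (fits? ks (x [ l ]≔ b))
          ( (λ { {w} (_ ∷ ks∈ , ∏≡x) → ks∈ , increment-≡ (∏ w) l eq (≡.trans (sym (∏-∷ l w)) ∏≡x) })
          , (λ { {w} (ks∈ , ∏≡x) → k∈ ∷ ks∈ , ≡.trans (∏-∷ l w) (≡-increment x l eq ∏≡x) }))
          ws))
        (words-count ks (x [ l ]≔ b))

occurrences-++ : ∀ (s : Fin n) v w → occurrences s (v ++ w) ≡ occurrences s v + occurrences s w
occurrences-++ s v w = ≡.trans
  (cong length (filter-++ (s Fin.≟_) v w))
  (length-++ (filter (s Fin.≟_) v))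

occurrences-↭ : ∀ {v w} (s : Fin n) → v ↭ w → occurrences s v ≡ occurrences s w
occurrences-↭ s v↭w = ↭-length (filter-↭ (s Fin.≟_) v↭w)

occurrences-allFin : ∀ (s : Fin n) → occurrences s (allFin n) ≡ 1
occurrences-allFin {n} s = ≤-antisym
  (unique⇒occurrences≤1 s (Unique.allFin⁺ n)) (filter-some (s Fin.≟_) (∈-allFin s))

-- The two arcs between a pair of vertices

module _ {n : ℕ} where

  -- Edges are named by their starting vertices, so this also says that the two directions together
  -- traverse each boundary edge once.
  Cycle : Fin n → Fin n → Set
  Cycle i j = i ∷ between i j ++ j ∷ between j i ↭ allFin n

  module _ {i j : Fin n} (i<j : i Fin.< j) (s : SortedSplit (allFin n) i j) where
    open SortedSplit s

    between-< : between i j ≡ X₁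
    between-< with i Fin.≤? j
    ... | no i≰j = contradiction (<⇒≤ i<j) i≰j
    ... | yes _  = begin
      filter B? (allFin n)
        ≡⟨ cong (filter B?) split≡ ⟩
      filter B? (X₀ ++ i ∷ X₁ ++ j ∷ X₂)
        ≡⟨ filter-++ B? X₀ _ ⟩
      filter B? X₀ ++ filter B? (i ∷ X₁ ++ j ∷ X₂)
        ≡⟨ cong₂ _++_ (filter-none B? (All.map (λ k<i (i<k , _) → <-asym k<i i<k) X₀<u))
             (filter-reject B? (λ (i<i , _) → <-irrefl refl i<i)) ⟩
      filter B? (X₁ ++ j ∷ X₂)
        ≡⟨ filter-++ B? X₁ _ ⟩
      filter B? X₁ ++ filter B? (j ∷ X₂)
        ≡⟨ cong₂ _++_ (filter-all B? (All.zip (u<X₁ , X₁<v)))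
             (filter-none B? ((λ (_ , j<j) → <-irrefl refl j<j)
               ∷ All.map (λ j<k (_ , k<j) → <-asym j<k k<j) v<X₂)) ⟩
      X₁ ++ []
        ≡⟨ ++-identityʳ X₁ ⟩
      X₁
        ∎
      where
      open ≡-Reasoning
      B? : Decidable (λ k → i Fin.< k × k Fin.< j)
      B? k = (i Fin.<? k) ×-dec (k Fin.<? j)

    between-> : between j i ≡ X₂ ++ X₀
    between-> with j Fin.≤? i
    ... | yes j≤i = contradiction j≤i (<⇒≱ i<j)
    ... | no _    = cong₂ _++_ above below
      where
      open ≡-Reasoning
      above : filter (j Fin.<?_) (allFin n) ≡ X₂
      above = begin
        filter (j Fin.<?_) (allFin n)
          ≡⟨ cong (filter (j Fin.<?_)) (≡.trans split≡ (sym (++-assoc X₀ (i ∷ X₁) _))) ⟩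
        filter (j Fin.<?_) ((X₀ ++ i ∷ X₁) ++ j ∷ X₂)
          ≡⟨ filter-++ (j Fin.<?_) (X₀ ++ i ∷ X₁) _ ⟩
        filter (j Fin.<?_) (X₀ ++ i ∷ X₁) ++ filter (j Fin.<?_) (j ∷ X₂)
          ≡⟨ cong₂ _++_
               (filter-none (j Fin.<?_)
                 (++⁺ (All.map (λ k<i j<k → <-asym (<-trans k<i i<j) j<k) X₀<u)
                      (<-asym i<j ∷ All.map (λ k<j → <-asym k<j) X₁<v)))
               (filter-reject (j Fin.<?_) (<-irrefl refl)) ⟩
        filter (j Fin.<?_) X₂
          ≡⟨ filter-all (j Fin.<?_) v<X₂ ⟩
        X₂
          ∎
      below : filter (Fin._<? i) (allFin n) ≡ X₀
      below = begin
        filter (Fin._<? i) (allFin n)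
          ≡⟨ cong (filter (Fin._<? i)) split≡ ⟩
        filter (Fin._<? i) (X₀ ++ i ∷ X₁ ++ j ∷ X₂)
          ≡⟨ filter-++ (Fin._<? i) X₀ _ ⟩
        filter (Fin._<? i) X₀ ++ filter (Fin._<? i) (i ∷ X₁ ++ j ∷ X₂)
          ≡⟨ cong₂ _++_ (filter-all (Fin._<? i) X₀<u)
               (filter-none (Fin._<? i) (<-irrefl refl
                 ∷ ++⁺ (All.map (λ i<k → <-asym i<k) u<X₁)
                       (<-asym i<j ∷ All.map (λ j<k → <-asym (<-trans i<j j<k)) v<X₂))) ⟩
        X₀ ++ []
          ≡⟨ ++-identityʳ X₀ ⟩
        X₀
          ∎

    cycle-< : Cycle i j
    cycle-< rewrite between-< | between-> = ↭-trans
      (solve 5 (λ i x j y z → i ⊕ x ⊕ j ⊕ y ⊕ z ⊜ z ⊕ i ⊕ x ⊕ j ⊕ y)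
        ↭-refl (i ∷ []) X₁ (j ∷ []) X₂ X₀)
      (↭-reflexive (sym split≡))
      where
      open import Algebra.Solver.CommutativeMonoid (++-commutativeMonoid {A = Fin n})
        using (solve; _⊜_; _⊕_)

    balanced-between-< : ∀ {P} → WalkSymmetric P (allFin n) →
                         Balanced P (between i j) (between j i)
    balanced-between-< symP rewrite between-< | between-> = symP split≡

  splitAt : ∀ {i j : Fin n} → i Fin.< j → SortedSplit (allFin n) i j
  splitAt {i} {j} = sorted-split₂ allFin-sorted (∈-allFin i) (∈-allFin j)

  cycle : ∀ {i j : Fin n} → i ≢ j → Cycle i j
  cycle {i} {j} i≢j with Fin.<-cmp i j
  ... | tri< i<j _ _ = cycle-< i<j (splitAt i<j)
  ... | tri≈ _ i≡j _ = contradiction i≡j i≢j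
  ... | tri> _ _ j<i =
    ↭-trans (++-comm (i ∷ between i j) (j ∷ between j i)) (cycle-< j<i (splitAt j<i))

  balanced-between : ∀ {P} {i j : Fin n} → WalkSymmetric P (allFin n) → i ≢ j →
                     Balanced P (between i j) (between j i)
  balanced-between {i = i} {j} symP i≢j with Fin.<-cmp i j
  ... | tri< i<j _ _ = balanced-between-< i<j (splitAt i<j) symP
  ... | tri≈ _ i≡j _ = contradiction i≡j i≢j
  ... | tri> _ _ j<i = Balanced-sym (balanced-between-< j<i (splitAt j<i) symP)

  vertices-⊤ : vertices (⊤ {n}) ≡ allFin n
  vertices-⊤ = filter-all (_∈? ⊤) (All.universal (λ _ → ∈⊤) (allFin n))

  edges-complement : ∀ {i j : Fin n} → i ≢ j → ∀ s →
    occurrences s (i ∷ between i j) + occurrences s (j ∷ between j i) ≡ 1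
  edges-complement {i} {j} i≢j s = begin
    occurrences s (i ∷ between i j) + occurrences s (j ∷ between j i)
      ≡⟨ occurrences-++ s (i ∷ between i j) _ ⟨
    occurrences s (i ∷ between i j ++ j ∷ between j i)
      ≡⟨ occurrences-↭ s (cycle i≢j) ⟩
    occurrences s (allFin n)
      ≡⟨ occurrences-allFin s ⟩
    1
      ∎
    where open ≡-Reasoning

-- Comparison of the coefficients

module _ {n : ℕ} (D : Dissection n) where
  open Dissection D using (diagonals; areDiagonal)

  private
    M = #pieces D

  pieces-symmetric : WalkSymmetric (pieces D) (allFin n)
  pieces-symmetric = subst (WalkSymmetric (pieces D)) vertices-⊤
    (walkSymmetric diagonals (All.map (λ (1+a<b , _) → <-trans (n<1+n _) 1+a<b) areDiagonal) ⊤)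

  -- g is left open to cover both the weights of walks and, for ψ, their complements.
  coeff-walkSum : ∀ i j (g : List (Fin M) → Monomial M n) μ {Q : Pred (List (Fin M)) 0ℓ}
    (Q? : Decidable Q) → (λ w → IsWalk D i j w × g w ≡ μ) ≐ Q →
    coeff (map (λ w → 1ℤ , g w) (walks D i j)) μ ≡
    ℤ.+ length (filter Q? (words M (length (between i j))))
  coeff-walkSum i j g μ Q? ≐Q = ≡.trans (coeff-map g (walks D i j) μ) (cong ℤ.+_ (≡.trans
    (length-filter-filter (isWalk? D i j) (λ w → g w ≟ᴹ μ) ws)
    (cong length (filter-≐ (λ w → isWalk? D i j w ×-dec g w ≟ᴹ μ) Q? ≐Q ws))))
    where
    ws = words M (length (between i j))

  coeff-walkSum-0 : ∀ i j (g : List (Fin M) → Monomial M n) μ →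
    (∀ w → IsWalk D i j w → g w ≢ μ) → coeff (map (λ w → 1ℤ , g w) (walks D i j)) μ ≡ ℤ.0ℤ
  coeff-walkSum-0 i j g μ g≢μ = ≡.trans
    (coeff-walkSum i j g μ none? ((λ (walk , eq) → g≢μ _ walk eq) , λ ()))
    (cong ℤ.+_ (length-filter-none none? (λ _ ()) (words M (length (between i j)))))
    where
    none? : Decidable {A = List (Fin M)} (λ _ → ⊥)
    none? _ = no λ ()

  complementSum-walkSum : ∀ i j → complementSum D (walkSum D i j) ≡
    map (λ w → 1ℤ , complement D (weight D i j w)) (walks D i j)
  complementSum-walkSum i j = sym (map-∘ (walks D i j))

  private
    cap : Fin M → ℕ
    cap l = degree D l ∸ 2

    edges : Fin n → Fin n → Vec ℕ n
    edges i j = ∏ (i ∷ between i j)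

    flipped : Vec ℕ M → Vec ℕ M
    flipped x = Vec.tabulate λ l → cap l ∸ Vec.lookup x l

    _Below-cap : Vec ℕ M → Set
    x Below-cap = ∀ l → Vec.lookup x l ≤ cap l

    below-cap-∏ : ∀ w → (∀ l → occurrences l w ≤ cap l) → ∏ w Below-cap
    below-cap-∏ w occ l = subst (_≤ cap l) (sym (Vec.lookup∘tabulate _ l)) (occ l)

    below-cap-∏⁻ : ∀ w → ∏ w Below-cap → ∀ l → occurrences l w ≤ cap l
    below-cap-∏⁻ w occ l = subst (_≤ cap l) (Vec.lookup∘tabulate _ l) (occ l)

    flipped-below : ∀ x → flipped x Below-cap
    flipped-below x l =
      subst (_≤ cap l) (sym (Vec.lookup∘tabulate _ l)) (m∸n≤m (cap l) (Vec.lookup x l))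

    flipped-involutive : ∀ {x} → x Below-cap → flipped (flipped x) ≡ x
    flipped-involutive {x} x≤ = ≡.trans (Vec.tabulate-cong λ l → ≡.trans
      (cong (cap l ∸_) (Vec.lookup∘tabulate _ l)) (m∸[m∸n]≡n (x≤ l))) (Vec.tabulate∘lookup x)

  complement-edges : ∀ {i j} → i ≢ j →
    Vec.tabulate (λ s → 1 ∸ Vec.lookup (edges i j) s) ≡ edges j i
  complement-edges {i} {j} i≢j = Vec.tabulate-cong λ s → begin
    1 ∸ Vec.lookup (edges i j) s
      ≡⟨ cong (1 ∸_) (Vec.lookup∘tabulate _ s) ⟩
    1 ∸ occurrences s (i ∷ between i j)
      ≡⟨ cong (_∸ occurrences s (i ∷ between i j)) (edges-complement i≢j s) ⟨
    occurrences s (i ∷ between i j) + occurrences s (j ∷ between j i)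
      ∸ occurrences s (i ∷ between i j)
      ≡⟨ m+n∸m≡n (occurrences s (i ∷ between i j)) _ ⟩
    occurrences s (j ∷ between j i)
      ∎
    where open ≡-Reasoning

  W-complementary : ∀ {i j} → Dec (i ≡ j) → ∀ μ →
    coeff (walkSum D j i) μ ≡ coeff (complementSum D (walkSum D i j)) μ
  W-complementary {i} (yes refl) μ = ≡.trans
    (coeff-walkSum-0 i i (weight D i i) μ λ { _ (i≢i , _) → contradiction refl i≢i })
    (sym (≡.trans (cong (λ f → coeff f μ) (complementSum-walkSum i i))
      (coeff-walkSum-0 i i (complement D ∘ weight D i i) μ
        λ { _ (i≢i , _) → contradiction refl i≢i })))
  W-complementary {i} {j} (no i≢j) (x , e) =
    byCases (Vec.≡-dec _≟_ e (edges j i) ×-dec Fin.all? (λ l → Vec.lookup x l ≤? cap l))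
    where
    open ≡-Reasoning
    byCases : Dec (e ≡ edges j i × x Below-cap) →
      coeff (walkSum D j i) (x , e) ≡ coeff (complementSum D (walkSum D i j)) (x , e)
    -- The coefficient is 0 on both sides: walks from j to i respect the bounds and have these
    -- edges, and complementing the weight of a walk from i to j yields a monomial of the same kind.
    byCases (no ¬attained) = ≡.trans
      (coeff-walkSum-0 j i (weight D j i) (x , e)
        λ { w (_ , _ , occ) refl → ¬attained (refl , below-cap-∏ w occ) })
      (sym (≡.trans (cong (λ f → coeff f (x , e)) (complementSum-walkSum i j))
        (coeff-walkSum-0 i j (complement D ∘ weight D i j) (x , e)
          λ { w _ refl → ¬attained (complement-edges i≢j , flipped-below (∏ w)) })))
    byCases (yes (refl , x≤cap)) = begin
      coeff (walkSum D j i) (x , e)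
        ≡⟨ coeff-walkSum j i (weight D j i) (x , e) (fits? (pieces D) (between j i) x)
             ( (λ { {w} ((_ , inc , _) , refl) → inc , refl })
             , (λ { {w} (inc , refl) → (i≢j ∘ sym , inc , below-cap-∏⁻ w x≤cap) , refl })) ⟩
      ℤ.+ length (filter (fits? (pieces D) (between j i) x) (words M (length (between j i))))
        ≡⟨ cong ℤ.+_ (words-count (pieces D) (between j i) x) ⟩
      ℤ.+ count (between j i) (toContent (pieces D) x)
        ≡⟨ cong ℤ.+_ (balanced-between pieces-symmetric i≢j .balance
             (toContent-complementary (pieces D) (flipped x) x λ l → ≡.trans
               (cong (_+ Vec.lookup x l) (Vec.lookup∘tabulate _ l)) (m∸n+n≡m (x≤cap l)))) ⟨
      ℤ.+ count (between i j) (toContent (pieces D) (flipped x))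
        ≡⟨ cong ℤ.+_ (words-count (pieces D) (between i j) (flipped x)) ⟨
      ℤ.+ length (filter (fits? (pieces D) (between i j) (flipped x))
                         (words M (length (between i j))))
        ≡⟨ coeff-walkSum i j (complement D ∘ weight D i j) (x , e)
             (fits? (pieces D) (between i j) (flipped x))
             -- The content of w is recovered by complementing x back, which is correct since that
             -- content lies within the bounds.
             ( (λ { {w} ((_ , inc , occ) , eq) → inc , ≡.trans
                    (sym (flipped-involutive (below-cap-∏ w occ)))
                    (cong (flipped ∘ proj₁) eq) })
             , (λ { {w} (inc , eq) →
                    (i≢j , inc , below-cap-∏⁻ w (subst _Below-cap (sym eq) (flipped-below x)))
                    , cong₂ _,_ (≡.trans (cong flipped eq) (flipped-involutive x≤cap))
                                (complement-edges i≢j) })) ⟨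
      coeff (map (λ w → 1ℤ , complement D (weight D i j w)) (walks D i j)) (x , e)
        ≡⟨ cong (λ f → coeff f (x , e)) (complementSum-walkSum i j) ⟨
      coeff (complementSum D (walkSum D i j)) (x , e)
        ∎

corollary4p3 : (n : ℕ) → n ≥ 3 → (D : Dissection n) (i j : Fin n) →
    _≈_ D (W D j i) (ψ D (W D i j))
corollary4p3 n _ D i j = W-complementary D (i Fin.≟ j)
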